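{- Let $n\ge1$ and let $\mathcal{L}$ be the vertex labeling of the linear representation of some linked cycle on $[n]$. Let $LC_n(\mathcal{L})$ be the set of linked cycles on $[n]$ whose linear representation has vertex labeling $\mathcal{L}$. Call the vertices of $\mathcal{L}$ labeled $i^{(j)}$ with $j\ge1$ that are not isolated points left endpoints, and the vertices labeled $i^{(0)}$ right endpoints. For a left endpoint $v$ let $h(v)$ be the number of right endpoints to the right of $v$ minus the number of left endpoints to the right of $v$. Then $$\sum_{\hat\pi\in LC_n(\mathcal{L})}x^{cr_2(\hat\pi)}y^{ne_2(\hat\pi)}=\sum_{\hat\pi\in LC_n(\mathcal{L})}x^{ne_2(\hat\pi)}y^{cr_2(\hat\pi)}=\prod_{v}\left(x^{h(v)-1}+x^{h(v)-2}y+\cdots+xy^{h(v)-2}+y^{h(v)-1}\right),$$ the product being over all left endpoints $v$ of $\mathcal{L}$. In particular $cr_2$ and $ne_2$ have a symmetric joint distribution over $LC_n(\mathcal{L})$.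
   Context: Two finite sets of integers $E,F$ are nearly disjoint if for every $i\in E\cap F$ either ($i=\min(E)$, $|E|>1$, $i\ne\min(F)$) or ($i=\min(F)$, $|F|>1$, $i\ne\min(E)$). A linked partition of $[n]$ is a set of nonempty subsets (blocks) of $[n]$ with union $[n]$, any two distinct blocks nearly disjoint; each element lies in one or two blocks (singly/doubly covered). A linked cycle on $[n]$ is a linked partition of $[n]$ with a cyclic arrangement of each block; a cycle is written $(i_1i_2\dots i_t)$ with $i_1$ its minimum. Linear representation of a linked cycle $\hat\pi$: for each $i\in[n]$ create vertices: if $i$ is singly covered and the minimum of its cycle, of size $k+1$, create $i^{(1)},\dots,i^{(k)}$ if $k\ge1$, and a single isolated vertex $i^{(1)}$ if $k=0$; if $i$ is singly covered and not the minimum of its cycle, create $i^{(0)}$; if $i$ is doubly covered and the minimum of a cycle of size $k+1$, create $i^{(0)},i^{(1)},\dots,i^{(k)}$. Vertices lie on a line ordered by $i$, then by superscript. For each cycle $(i_1\dots i_t)$, $t\ge2$, draw arcs $(i_1^{(j)},i_{t+1-j}^{(0)})$, $j=1,\dots,t-1$. The vertex labeling is the left-to-right sequence of vertex labels. Two arcs $(x_1,y_1),(x_2,y_2)$ form a 2-crossing if the vertices appear in the order $x_1,x_2,y_1,y_2$, and a 2-nesting if in the order $x_1,x_2,y_2,y_1$; $cr_2(\hat\pi)$, $ne_2(\hat\pi)$ are the numbers of these.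
   Formalization: The vertex labeling is taken to record also which vertices are isolated points; the bare sequence of labels does not determine this (1^(1) 2^(1) 3^(0) arises from both (1)(2 3) and (1 3)(2)), and the formula fails for bare sequences. -}

module Defs where

open import Algebra.Bundles using (CommutativeSemiring)
open import Data.Bool.Base using (Bool; true; false)
open import Data.Fin.Base as Fin using (Fin)
import Data.Fin.Properties as Fin
open import Data.Fin.Subset using (Subset; ⁅_⁆; ⋃; ⊤; ∣_∣; Nonempty) renaming (_∈_ to _∈ₛ_)
open import Data.Fin.Subset.Properties using () renaming (_∈?_ to _∈ₛ?_)
open import Data.List.Base using (List; []; _∷_; map; concatMap; filter; filterᵇ; foldr; length; reverse; upTo; allFin; zip; cartesianProduct)
open import Data.List.Membership.Propositional using (_∈_)
import Data.List.Relation.Unary.Enumerates.Setoid as EnumeratesSetoid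
open import Data.List.Relation.Binary.Permutation.Propositional using (↭-setoid)
open import Data.List.Relation.Unary.All using (All)
open import Data.List.Relation.Unary.Unique.Propositional using (Unique)
import Data.List.Relation.Unary.Unique.Setoid as UniqueSetoid
open import Data.List.NonEmpty.Base using (List⁺; _∷_; head; toList)
open import Data.Nat.Base using (ℕ; zero; suc; _∸_; _<_; _>_)
import Data.Nat.Properties as ℕ
open import Data.Product.Base using (Σ; _×_; _,_; proj₁; proj₂)
open import Data.Product.Relation.Binary.Lex.Strict using (×-Lex; ×-decidable)
open import Data.Sum.Base using (_⊎_)
open import Level using (0ℓ)
open import Relation.Binary.Bundles using (Setoid)
open import Relation.Binary.Core using (Rel)
open import Relation.Binary.Definitions using (Decidable)
import Relation.Binary.Construct.On as On
open import Relation.Binary.PropositionalEquality.Core using (_≡_; _≢_)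
open import Relation.Nullary.Negation.Core using (¬_)
open import Relation.Nullary.Decidable using (_×-dec_)
import Relation.Unary as Unary

-- The ground set [n] = {1 < 2 < ⋯ < n} is represented by Fin n with its order.

IsMin : ∀ {n} → Fin n → Subset n → Set
IsMin i E = i ∈ₛ E × (∀ {j} → j ∈ₛ E → i Fin.≤ j)

NearlyDisjoint : ∀ {n} → Subset n → Subset n → Set
NearlyDisjoint E F = ∀ i → i ∈ₛ E → i ∈ₛ F →
    (IsMin i E × ∣ E ∣ > 1 × ¬ IsMin i F)
  ⊎ (IsMin i F × ∣ F ∣ > 1 × ¬ IsMin i E)

-- A set of blocks is given by a duplicate-free list.
record IsLinkedPartition {n : ℕ} (blocks : List (Subset n)) : Set where
  field
    distinct : Unique blocks
    nonempty : All Nonempty blocks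
    union    : ⋃ blocks ≡ ⊤
    linked   : ∀ {E F} → E ∈ blocks → F ∈ blocks → E ≢ F → NearlyDisjoint E F

-- A cyclic arrangement (i₁ i₂ … iₜ) of a block is given by its unique writing
-- that starts with the minimum i₁ of the block.
IsCycle : ∀ {n} → List⁺ (Fin n) → Set
IsCycle (i₁ ∷ is) = All (i₁ Fin.<_) is × Unique is

block : ∀ {n} → List⁺ (Fin n) → Subset n
block c = ⋃ (map ⁅_⁆ (toList c))

record LinkedCycle (n : ℕ) : Set where
  field
    cycles            : List (List⁺ (Fin n))
    isCycle           : All IsCycle cycles
    isLinkedPartition : IsLinkedPartition (map block cycles)

open LinkedCycle public

-- A linked cycle is a set of cycles, so the order in which they are listed is
-- irrelevant: two linked cycles are equal when their lists of cycles are
-- permutations of each other.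
linkedCycleSetoid : ℕ → Setoid 0ℓ 0ℓ
linkedCycleSetoid n = On.setoid (↭-setoid {A = List⁺ (Fin n)}) cycles

-- The vertex i^(j) is the pair (i , j).
Vertex : ℕ → Set
Vertex n = Fin n × ℕ

infix 4 _≺_ _≺?_

_≺_ : ∀ {n} → Rel (Vertex n) 0ℓ
_≺_ = ×-Lex _≡_ Fin._<_ _<_

_≺?_ : ∀ {n} → Decidable (_≺_ {n})
_≺?_ = ×-decidable Fin._≟_ Fin._<?_ ℕ._<?_

-- The superscripts alone do not tell an isolated vertex i^(1) from the vertex
-- i^(1) of a 2-element cycle with minimum i, so labels record this information.
data Label (n : ℕ) : Set where
  endpoint : Vertex n → Label n
  isolated : Vertex n → Label n

vertex : ∀ {n} → Label n → Vertex n
vertex (endpoint v) = v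
vertex (isolated v) = v

isLeft : ∀ {n} → Label n → Bool
isLeft (endpoint (_ , suc _)) = true
isLeft (endpoint (_ , zero))  = false
isLeft (isolated _)           = false

isRight : ∀ {n} → Label n → Bool
isRight (endpoint (_ , zero))  = true
isRight (endpoint (_ , suc _)) = false
isRight (isolated _)           = false

leftEndpoints rightEndpoints : ∀ {n} → List (Label n) → List (Vertex n)
leftEndpoints  L = map vertex (filterᵇ isLeft L)
rightEndpoints L = map vertex (filterᵇ isRight L)

-- [ 1 , 2 , … , k ]
upFrom1 : ℕ → List ℕ
upFrom1 k = map suc (upTo k)

-- The labels created for i, given the number of cycles covering i and the list
-- of cycles with minimum i. The catch-all case never occurs in a linked cycle:
-- every element is covered once or twice, nearly disjoint blocks have distinct
-- minima, and a doubly covered element is the minimum of one of its cycles.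
labelsFrom : ∀ {n} → Fin n → ℕ → List (List⁺ (Fin n)) → List (Label n)
labelsFrom i 1 ((_ ∷ []) ∷ [])            = isolated (i , 1) ∷ []
labelsFrom i 1 ((_ ∷ is@(_ ∷ _)) ∷ [])    = map (λ j → endpoint (i , j)) (upFrom1 (length is))
labelsFrom i 1 []                         = endpoint (i , 0) ∷ []
labelsFrom i 2 ((_ ∷ is) ∷ [])            = map (λ j → endpoint (i , j)) (0 ∷ upFrom1 (length is))
labelsFrom i _ _                          = []

labelsOf : ∀ {n} → LinkedCycle n → Fin n → List (Label n)
labelsOf π i = labelsFrom i
  (length (filter (λ c → i ∈ₛ? block c) (cycles π)))
  (filter (λ c → head c Fin.≟ i) (cycles π))

labeling : ∀ {n} → LinkedCycle n → List (Label n)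
labeling {n} π = concatMap (labelsOf π) (allFin n)

Arc : ℕ → Set
Arc n = Vertex n × Vertex n

-- The j-th entry of the list iₜ, iₜ₋₁, …, i₂ is iₜ₊₁₋ⱼ.
cycleArcs : ∀ {n} → List⁺ (Fin n) → List (Arc n)
cycleArcs (i₁ ∷ is) =
  map (λ (j , i) → (i₁ , j) , (i , 0)) (zip (upFrom1 (length is)) (reverse is))

arcs : ∀ {n} → LinkedCycle n → List (Arc n)
arcs π = concatMap cycleArcs (cycles π)

Crossing Nesting : ∀ {n} → Arc n × Arc n → Set
Crossing ((x₁ , y₁) , (x₂ , y₂)) = x₁ ≺ x₂ × x₂ ≺ y₁ × y₁ ≺ y₂
Nesting  ((x₁ , y₁) , (x₂ , y₂)) = x₁ ≺ x₂ × x₂ ≺ y₂ × y₂ ≺ y₁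

crossing? : ∀ {n} → Unary.Decidable (Crossing {n})
crossing? ((x₁ , y₁) , (x₂ , y₂)) = (x₁ ≺? x₂) ×-dec (x₂ ≺? y₁) ×-dec (y₁ ≺? y₂)

nesting? : ∀ {n} → Unary.Decidable (Nesting {n})
nesting? ((x₁ , y₁) , (x₂ , y₂)) = (x₁ ≺? x₂) ×-dec (x₂ ≺? y₂) ×-dec (y₂ ≺? y₁)

-- Counting ordered pairs of arcs counts each crossing and each nesting once,
-- since x₁ ≺ x₂ fixes the order of the pair.
cr₂ ne₂ : ∀ {n} → LinkedCycle n → ℕ
cr₂ π = length (filter crossing? (cartesianProduct (arcs π) (arcs π)))
ne₂ π = length (filter nesting? (cartesianProduct (arcs π) (arcs π)))

LC : (n : ℕ) → List (Label n) → Setoid 0ℓ 0ℓ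
LC n L = On.setoid {B = Σ (LinkedCycle n) λ π → labeling π ≡ L} (linkedCycleSetoid n) proj₁

record Enumerates {a ℓ} (S : Setoid a ℓ) (xs : List (Setoid.Carrier S)) : Set (a Level.⊔ ℓ) where
  field
    complete     : EnumeratesSetoid.IsEnumeration S xs
    noDuplicates : UniqueSetoid.Unique S xs

-- Every left endpoint is joined to a right endpoint to its right, so for the
-- labeling of a linked cycle h L v ≥ 1 and the subtraction is not truncated.
h : ∀ {n} → List (Label n) → Vertex n → ℕ
h L v = length (filter (v ≺?_) (rightEndpoints L)) ∸ length (filter (v ≺?_) (leftEndpoints L))

-- An identity of polynomials in x and y can be stated as an identity for all
-- elements x, y of all commutative semirings, which include the polynomial
-- rings themselves.
module GeneratingFunctions {c ℓ} (R : CommutativeSemiring c ℓ) where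
  open CommutativeSemiring R public using (Carrier; _≈_; _+_; _*_; 0#; 1#)
  open CommutativeSemiring R using (semiring)
  open import Algebra.Properties.Semiring.Exp semiring public using (_^_)

  ∑ ∏ : ∀ {a} {A : Set a} → List A → (A → Carrier) → Carrier
  ∑ as f = foldr _+_ 0# (map f as)
  ∏ as f = foldr _*_ 1# (map f as)

  -- xᵐ⁻¹ + xᵐ⁻²y + ⋯ + xyᵐ⁻² + yᵐ⁻¹
  [_]⟨_,_⟩ : ℕ → Carrier → Carrier → Carrier
  [ m ]⟨ x , y ⟩ = ∑ (upTo m) λ k → x ^ (m ∸ 1 ∸ k) * y ^ k

-- The number of π in the list with f π = a and g π = b.
jointCount : ∀ {A : Set} → (A → ℕ) → (A → ℕ) → ℕ → ℕ → List A → ℕ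
jointCount f g a b πs = length (filter (λ π → (f π ℕ.≟ a) ×-dec (g π ℕ.≟ b)) πs)

{-# OPTIONS --safe #-}
module Submission where

-- A linked cycle with a given labeling is the same thing as a perfect matching of
-- the left endpoints with the right endpoints in which every arc goes to the right:
-- the arcs at i, read from the last left endpoint i^(t-1) to the first i^(1), end
-- in the elements i₂, …, iₜ of the cycle with minimum i.
--
-- Build a matching by treating the left endpoints from right to left. When v is
-- treated, exactly h(v) right endpoints to the right of v are still free, and all of
-- them but the chosen one are later matched to left endpoints to the left of v. Hence
-- choosing the (k + 1)-st of them creates k crossings and h(v) - 1 - k nestings, and
-- the generating function is the product of the factors x^(h(v)-1) + ⋯ + y^(h(v)-1).
-- Reversing the order of the choices at each v interchanges crossings and nestings.

open import Defs
open import Algebra.Bundles using (CommutativeSemiring)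
open import Algebra.Properties.CommutativeSemigroup using (interchange)
open import Algebra.Properties.Semiring.Exp using (^-homo-*)
open import Data.Bool.Base using (Bool; true; false; if_then_else_)
import Data.Bool.Properties as Bool
open import Data.Fin.Base as Fin using (Fin)
import Data.Fin.Properties as Fin
open import Data.Fin.Subset using (⁅_⁆; ⋃; ∣_∣) renaming (_∈_ to _∈ₛ_)
open import Data.Fin.Subset.Properties
  using (x∈⁅x⁆; x∈⁅y⁆⇒x≡y; x∈p∪q⁻; x∈p∪q⁺; ∉⊥; ∈⊤; ⊆-antisym; ⊆⊤; p⊂q⇒∣p∣<∣q∣; ∣⁅x⁆∣≡1; ∪-identityʳ)
  renaming (_∈?_ to _∈ₛ?_)
open import Data.List.Base
open import Data.List.Membership.Propositional using (_∈_; _∉_)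
open import Data.List.Membership.Propositional.Properties
open import Data.List.Membership.Propositional.Properties.WithK using (unique∧set⇒bag)
open import Data.List.NonEmpty.Base as List⁺ using (List⁺; _∷_)
open import Data.List.Properties
open import Data.List.Relation.Binary.BagAndSetEquality using (∼bag⇒↭)
open import Data.List.Relation.Binary.Disjoint.Propositional using (Disjoint)
open import Data.List.Relation.Binary.Permutation.Propositional
  renaming (swap to ↭swap; trans to ↭trans)
open import Data.List.Relation.Binary.Permutation.Propositional.Properties
  using (All-resp-↭; ∈-resp-↭; ↭-length; drop-∷; filter-↭; ↭-reverse; shifts)
import Data.List.Relation.Binary.Permutation.Propositional.Properties as Perm
import Data.List.Relation.Binary.Permutation.Setoid.Properties as PermS
open import Data.List.Relation.Binary.Pointwise as Pointwise using (Pointwise; []; _∷_)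
open import Data.List.Relation.Unary.All as All using (All; []; _∷_)
import Data.List.Relation.Unary.All.Properties as All
open import Data.List.Relation.Unary.AllPairs as AllPairs using (AllPairs; []; _∷_)
import Data.List.Relation.Unary.AllPairs.Properties as AllPairs
open import Data.List.Relation.Unary.Any as Any using (Any; here; there)
open import Data.List.Relation.Unary.Unique.Propositional using (Unique)
import Data.List.Relation.Unary.Unique.Propositional.Properties as Unique
open import Data.Maybe.Base using (Maybe; just; nothing)
open import Data.Maybe.Properties using (just-injective)
open import Data.Nat.Base as ℕ using (ℕ; zero; suc; _≥_; _∸_; s≤s)
import Data.Nat.Properties as ℕ
open import Data.Product.Base using (∃; _×_; _,_; proj₁; proj₂; map₂; swap)
open import Data.Product.Relation.Binary.Lex.Strict using (×-transitive)
open import Data.Sum.Base using (_⊎_; inj₁; inj₂)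
open import Function.Base using (_∘_; id; flip)
open import Function.Bundles using (_⇔_; mk⇔; Equivalence)
open import Level using (0ℓ)
open import Relation.Binary.Bundles using (Setoid)
open import Relation.Binary.Core using (Rel; REL)
open import Relation.Binary.PropositionalEquality
  using (_≡_; _≢_; refl; sym; trans; cong; cong₂; subst; module ≡-Reasoning; setoid; resp₂; isEquivalence)
import Relation.Binary.Reasoning.Setoid as SetoidReasoning
open import Relation.Nullary.Decidable using (Dec; yes; no; does; _×-dec_)
open import Relation.Nullary.Negation using (¬_; contradiction)
open import Relation.Unary using (Pred; Decidable)

-- A linked cycle is a list of cycles up to permutation, so one list must be singled out before it
-- can be compared with a matching. Listing the cycles by descending minimum does this: the
-- concatenated tails are then the ends of the arcs, aligned with the left endpoints in descending
-- order. Nothing is lost, because the labeling prescribes the length of every tail and hence where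
-- to cut the concatenation. Near disjointness, a condition on pairs of blocks, does not fit this
-- cutting. It is therefore turned into conditions on the list of minima and the list of non-minimal
-- elements. The number of free right endpoints does not depend on the earlier choices: matching u
-- uses up one left and one right endpoint, both to the right of every left endpoint still to be
-- treated. This independence is what makes the sum factor. All counting is done with lists of
-- exponent pairs up to permutation. The polynomial identities and the equality of joint counts are
-- both read off from the same permutation.

private variable
  A B : Set
  x y : A
  xs ys : List A

-- Lists and permutations

unique∧set⇒↭ : Unique xs → Unique ys →
  (∀ {z} → z ∈ xs → z ∈ ys) → (∀ {z} → z ∈ ys → z ∈ xs) → xs ↭ ys
unique∧set⇒↭ xs! ys! to from = ∼bag⇒↭ (unique∧set⇒bag xs! ys! (mk⇔ to from))

Unique-resp-↭ : xs ↭ ys → Unique xs → Unique ys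
Unique-resp-↭ p = PermS.Unique-resp-↭ (setoid _) (↭⇒↭ₛ p)

-- If the heads differ, each occurs in the tail of the other list, so each precedes the other, which
-- asymmetry excludes.
asym-sorted-↭⇒≡ : {R : Rel A 0ℓ} → (∀ {x y} → R x y → ¬ R y x) →
  AllPairs R xs → AllPairs R ys → xs ↭ ys → xs ≡ ys
asym-sorted-↭⇒≡ asym [] _ p = sym (Perm.↭-empty-inv (↭-sym p))
asym-sorted-↭⇒≡ asym (_ ∷ _) [] p = contradiction p Perm.¬x∷xs↭[]
asym-sorted-↭⇒≡ asym (Rx ∷ Rxs) (Ry ∷ Rys) p
  with ∈-resp-↭ p (here refl) | ∈-resp-↭ (↭-sym p) (here refl)
... | here refl  | _          = cong (_ ∷_) (asym-sorted-↭⇒≡ asym Rxs Rys (drop-∷ p))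
... | there _    | here refl  = cong (_ ∷_) (asym-sorted-↭⇒≡ asym Rxs Rys (drop-∷ p))
... | there x∈ys | there y∈xs = contradiction (All.lookup Ry x∈ys) (asym (All.lookup Rx y∈xs))

concatMap⁺-↭ : (f : A → List B) → xs ↭ ys → concatMap f xs ↭ concatMap f ys
concatMap⁺-↭ f refl         = refl
concatMap⁺-↭ f (prep x p)   = Perm.++⁺ˡ (f x) (concatMap⁺-↭ f p)
concatMap⁺-↭ f (↭swap x y p) =
  ↭trans (shifts (f x) (f y)) (Perm.++⁺ˡ (f y) (Perm.++⁺ˡ (f x) (concatMap⁺-↭ f p)))
concatMap⁺-↭ f (↭trans p q)  = ↭trans (concatMap⁺-↭ f p) (concatMap⁺-↭ f q)

concatMap-cong-↭ : {f g : A → List B} → All (λ x → f x ↭ g x) xs →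
  concatMap f xs ↭ concatMap g xs
concatMap-cong-↭ []         = refl
concatMap-cong-↭ (p ∷ ps) = Perm.++⁺ p (concatMap-cong-↭ ps)

cartesianProduct-∷ʳ-↭ : (xs : List A) (y : B) (ys : List B) →
  cartesianProduct xs (y ∷ ys) ↭ map (_, y) xs ++ cartesianProduct xs ys
cartesianProduct-∷ʳ-↭ []       y ys = refl
cartesianProduct-∷ʳ-↭ (x ∷ xs) y ys = prep (x , y)
  (↭trans (Perm.++⁺ˡ (map (x ,_) ys) (cartesianProduct-∷ʳ-↭ xs y ys))
         (shifts (map (x ,_) ys) (map (_, y) xs)))

cartesianProduct⁺-↭ : {xs xs′ : List A} {ys ys′ : List B} → xs ↭ xs′ → ys ↭ ys′ →
  cartesianProduct xs ys ↭ cartesianProduct xs′ ys′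
cartesianProduct⁺-↭ {xs′ = xs′} {ys = ys} p q = ↭trans (left p) (right xs′)
  where
  left : ∀ {xs xs′} → xs ↭ xs′ → cartesianProduct xs ys ↭ cartesianProduct xs′ ys
  left refl         = refl
  left (prep x p)   = Perm.++⁺ˡ (map (x ,_) ys) (left p)
  left (↭swap x y p) = ↭trans (shifts (map (x ,_) ys) (map (y ,_) ys))
    (Perm.++⁺ˡ (map (y ,_) ys) (Perm.++⁺ˡ (map (x ,_) ys) (left p)))
  left (↭trans p q)  = ↭trans (left p) (left q)
  right : ∀ xs → cartesianProduct xs _ ↭ cartesianProduct xs _
  right []       = refl
  right (x ∷ xs) = Perm.++⁺ (Perm.map⁺ (x ,_) q) (right xs)

filter-map : {P : Pred B 0ℓ} (P? : Decidable P) (f : A → B) (xs : List A) →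
  filter P? (map f xs) ≡ map f (filter (P? ∘ f) xs)
filter-map P? f []       = refl
filter-map P? f (x ∷ xs) with does (P? (f x))
... | true  = cong (f x ∷_) (filter-map P? f xs)
... | false = filter-map P? f xs

count : {P : Pred A 0ℓ} → Decidable P → List A → ℕ
count P? xs = length (filter P? xs)

count-↭ : {P : Pred A 0ℓ} (P? : Decidable P) → xs ↭ ys → count P? xs ≡ count P? ys
count-↭ P? p = ↭-length (filter-↭ P? p)

count-map : {P : Pred B 0ℓ} (P? : Decidable P) (f : A → B) (xs : List A) →
  count P? (map f xs) ≡ count (P? ∘ f) xs
count-map P? f xs = trans (cong length (filter-map P? f xs)) (length-map f (filter (P? ∘ f) xs))

count-++ : {P : Pred A 0ℓ} (P? : Decidable P) (xs ys : List A) →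
  count P? (xs ++ ys) ≡ count P? xs ℕ.+ count P? ys
count-++ P? xs ys = trans (cong length (filter-++ P? xs ys)) (length-++ (filter P? xs))

count-none : {P : Pred A 0ℓ} (P? : Decidable P) → All (λ x → ¬ P x) xs → count P? xs ≡ 0
count-none P? none = cong length (filter-none P? none)

count-cong : {P : Pred A 0ℓ} {Q : Pred B 0ℓ} (P? : Decidable P) (Q? : Decidable Q) →
  Pointwise (λ x y → P x ⇔ Q y) xs ys → count P? xs ≡ count Q? ys
count-cong P? Q? []                         = refl
count-cong P? Q? (_∷_ {x = x} {y = y} e es) with P? x | Q? y
... | yes p | yes q = cong suc (count-cong P? Q? es)
... | no ¬p | no ¬q = count-cong P? Q? es
... | yes p | no ¬q = contradiction (Equivalence.to e p) ¬q
... | no ¬p | yes q = contradiction (Equivalence.from e q) ¬p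

-- Meant for `x` the arc with the rightmost left endpoint: it can only be the second arc of a
-- crossing or nesting, so of all pairs involving `x` only those with `x` in second place
-- contribute.
count-square-∷ : {P : Pred (A × A) 0ℓ} (P? : Decidable P) (x : A) (xs : List A) →
  All (λ y → ¬ P (x , y)) (x ∷ xs) →
  count P? (cartesianProduct (x ∷ xs) (x ∷ xs))
    ≡ count (P? ∘ (_, x)) xs ℕ.+ count P? (cartesianProduct xs xs)
count-square-∷ P? x xs none = begin
  count P? (map (x ,_) (x ∷ xs) ++ cartesianProduct xs (x ∷ xs))
    ≡⟨ count-++ P? (map (x ,_) (x ∷ xs)) _ ⟩
  count P? (map (x ,_) (x ∷ xs)) ℕ.+ count P? (cartesianProduct xs (x ∷ xs))
    ≡⟨ cong₂ ℕ._+_ (count-none P? (All.map⁺ none))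
                   (count-↭ P? (cartesianProduct-∷ʳ-↭ xs x xs)) ⟩
  count P? (map (_, x) xs ++ cartesianProduct xs xs)
    ≡⟨ count-++ P? (map (_, x) xs) _ ⟩
  count P? (map (_, x) xs) ℕ.+ count P? (cartesianProduct xs xs)
    ≡⟨ cong (ℕ._+ _) (count-map P? (_, x) xs) ⟩
  count (P? ∘ (_, x)) xs ℕ.+ count P? (cartesianProduct xs xs) ∎
  where open ≡-Reasoning

-- Perfect matchings

select : List A → List (A × List A)
select []       = []
select (x ∷ xs) = (x , xs) ∷ map (map₂ (x ∷_)) (select xs)

map-proj₁-select : (xs : List A) → map proj₁ (select xs) ≡ xs
map-proj₁-select []       = refl
map-proj₁-select (x ∷ xs) = cong (x ∷_) (trans (sym (map-∘ (select xs))) (map-proj₁-select xs))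

select-↭ : ∀ {y : A} {xs ys} → (y , ys) ∈ select xs → y ∷ ys ↭ xs
select-↭ {xs = _ ∷ _} (here refl) = refl
select-↭ {xs = x ∷ xs} (there p) with ∈-map⁻ (map₂ (x ∷_)) p
... | (y , ys) , q , refl = ↭trans (↭swap y x refl) (prep x (select-↭ q))

∈-select : ∀ {y : A} {xs} → y ∈ xs → ∃ λ ys → (y , ys) ∈ select xs
∈-select (here refl) = _ , here refl
∈-select (there {x = x} p) with ∈-select p
... | ys , q = x ∷ ys , there (∈-map⁺ (map₂ (x ∷_)) q)

-- The remainder is recovered only up to order. This suffices because `Matching` sees the right
-- endpoints up to permutation.
select-complete : ∀ {y : A} {xs ys} → y ∷ ys ↭ xs → ∃ λ ys′ → (y , ys′) ∈ select xs × ys ↭ ys′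
select-complete p with ∈-select (∈-resp-↭ p (here refl))
... | ys′ , q = ys′ , q , drop-∷ (↭trans p (↭-sym (select-↭ q)))

AllPairs-select : {R : Rel A 0ℓ} {y : A} {xs ys : List A} →
  AllPairs R xs → (y , ys) ∈ select xs → AllPairs R ys
AllPairs-select (_ ∷ Rxs) (here refl) = Rxs
AllPairs-select {xs = x ∷ xs} (Rx ∷ Rxs) (there p) with ∈-map⁻ (map₂ (x ∷_)) p
... | (y , ys) , q , refl =
  All.tail (All-resp-↭ (↭-sym (select-↭ q)) Rx) ∷ AllPairs-select Rxs q

choices : ∀ {n} → Vertex n → List (Vertex n) → List (Vertex n × List (Vertex n))
choices u vs = filter (λ (v , _) → u ≺? v) (select vs)

-- A matching is encoded by the list of its right ends, aligned with the fixed list of left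
-- endpoints, so that equality of matchings is equality of lists.
matchings : ∀ {n} → List (Vertex n) → List (Vertex n) → List (List (Vertex n))
matchings []       []      = [] ∷ []
matchings []       (_ ∷ _) = []
matchings (u ∷ us) vs      =
  concatMap (λ (y , vs′) → map (y ∷_) (matchings us vs′)) (choices u vs)

Matching : ∀ {n} → List (Vertex n) → List (Vertex n) → List (Vertex n) → Set
Matching us vs ys = Pointwise _≺_ us ys × ys ↭ vs

matchings-sound : ∀ {n} (us : List (Vertex n)) {vs ys} → ys ∈ matchings us vs → Matching us vs ys
matchings-sound [] {[]} (here refl) = [] , refl
matchings-sound (u ∷ us) {vs} p
  with ∈-concat⁻′ (map (λ (y , vs′) → map (y ∷_) (matchings us vs′)) (choices u vs)) p
... | _ , ys∈ , q with ∈-map⁻ (λ (y , vs′) → map (y ∷_) (matchings us vs′)) q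
... | (y , vs′) , r , refl with ∈-map⁻ (y ∷_) ys∈ | ∈-filter⁻ (λ (v , _) → u ≺? v) {xs = select vs} r
... | ys , s , refl | t , u≺y with matchings-sound us s
... | us≺ys , ys↭vs′ = u≺y ∷ us≺ys , ↭trans (prep y ys↭vs′) (select-↭ t)

matchings-complete : ∀ {n} {us vs ys : List (Vertex n)} → Matching us vs ys → ys ∈ matchings us vs
matchings-complete {vs = []}    ([] , _) = here refl
matchings-complete {vs = _ ∷ _} ([] , p) = contradiction (↭-sym p) Perm.¬x∷xs↭[]
matchings-complete {us = u ∷ us} (u≺y ∷ us≺ys , p) with select-complete p
... | vs′ , q , ys↭vs′ = ∈-concat⁺′
  (∈-map⁺ (_ ∷_) (matchings-complete (us≺ys , ys↭vs′)))
  (∈-map⁺ (λ (y , vs′) → map (y ∷_) (matchings us vs′)) (∈-filter⁺ (λ (v , _) → u ≺? v) q u≺y))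

matchings-unique : ∀ {n} (us : List (Vertex n)) {vs} → Unique vs → Unique (matchings us vs)
matchings-unique []       {[]}    _   = [] ∷ []
matchings-unique []       {_ ∷ _} _   = []
matchings-unique (u ∷ us) {vs}    vs! = Unique.concat⁺
  (All.map⁺ (All.tabulate λ c∈ → Unique.map⁺ ∷-injectiveʳ
    (matchings-unique us (AllPairs-select vs! (proj₁ (∈-filter⁻ (λ (v , _) → u ≺? v) {xs = select vs} c∈))))))
  (AllPairs.map⁺ (AllPairs.map disjoint (AllPairs.filter⁺ (λ (v , _) → u ≺? v)
    (AllPairs.map⁻ (subst Unique (sym (map-proj₁-select vs)) vs!)))))
  where
  -- Different choices for `u` give lists with different first entries.
  disjoint : ∀ {c d} → proj₁ c ≢ proj₁ d →
    Disjoint (map (proj₁ c ∷_) (matchings us (proj₂ c))) (map (proj₁ d ∷_) (matchings us (proj₂ d)))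
  disjoint c≢d (p , q) with ∈-map⁻ (_ ∷_) p | ∈-map⁻ (_ ∷_) q
  ... | _ , _ , refl | _ , _ , eq = c≢d (∷-injectiveˡ eq)

-- Crossings and nestings of matchings

≺-trans : ∀ {n} {u v w : Vertex n} → u ≺ v → v ≺ w → u ≺ w
≺-trans = ×-transitive {_<₂_ = ℕ._<_} isEquivalence (resp₂ Fin._<_) Fin.<-trans ℕ.<-trans

≺-irrefl : ∀ {n} {u : Vertex n} → ¬ u ≺ u
≺-irrefl (inj₁ i<i)       = Fin.<-irrefl refl i<i
≺-irrefl (inj₂ (_ , j<j)) = ℕ.<-irrefl refl j<j

≺-asym : ∀ {n} {u v : Vertex n} → u ≺ v → ¬ v ≺ u
≺-asym p q = ≺-irrefl (≺-trans p q)

_≻_ : ∀ {n} → Rel (Vertex n) 0ℓ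
_≻_ = flip _≺_

-- The exponents of the monomials of [ m ]⟨ x , y ⟩.
terms : ℕ → List (ℕ × ℕ)
terms m = map (λ k → m ∸ 1 ∸ k , k) (upTo m)

infixr 6 _⊕_

_⊕_ : ℕ × ℕ → ℕ × ℕ → ℕ × ℕ
(a , b) ⊕ (c , d) = a ℕ.+ c , b ℕ.+ d

-- The exponents, with multiplicity, of all monomials in the expanded product of the factors
-- `[ m ]⟨ x , y ⟩`.
productTerms : List ℕ → List (ℕ × ℕ)
productTerms []       = (0 , 0) ∷ []
productTerms (m ∷ ms) = concatMap (λ t → map (t ⊕_) (productTerms ms)) (terms m)

-- The recursion that a new leftmost candidate causes in `map-increment-choices`: choosing it gives
-- `m` nestings and no crossing, and its presence adds one crossing to every other choice.
terms-suc : ∀ m → terms (suc m) ≡ (m , 0) ∷ map (map₂ suc) (terms m)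
terms-suc m = cong ((m , 0) ∷_) (begin
  map (λ k → m ∸ k , k) (applyUpTo suc m)                  ≡⟨ map-applyUpTo suc _ m ⟩
  applyUpTo (λ k → m ∸ suc k , suc k) m                    ≡⟨ map-upTo _ m ⟨
  map (λ k → m ∸ suc k , suc k) (upTo m)
    ≡⟨ map-cong (λ k → cong (_, suc k) (sym (ℕ.∸-+-assoc m 1 k))) (upTo m) ⟩
  map (λ k → m ∸ 1 ∸ k , suc k) (upTo m)                   ≡⟨ map-∘ (upTo m) ⟩
  map (map₂ suc) (terms m)                                 ∎)
  where open ≡-Reasoning

crossings nestings : ∀ {n} → List (Arc n) → ℕ
crossings as = count crossing? (cartesianProduct as as)
nestings  as = count nesting? (cartesianProduct as as)

-- Nestings come first to agree with `terms`, whose entries run from many nestings to many crossings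
-- as the chosen end moves to the right.
exponents : ∀ {n} → List (Arc n) → ℕ × ℕ
exponents as = nestings as , crossings as

exponents-↭ : ∀ {n} {as bs : List (Arc n)} → as ↭ bs → exponents as ≡ exponents bs
exponents-↭ p = cong₂ _,_ (count-↭ nesting? (cartesianProduct⁺-↭ p p))
                          (count-↭ crossing? (cartesianProduct⁺-↭ p p))

-- When u is matched to y and the vertices of vs are to be matched to vertices
-- to the left of u, the new arc is nested in the arcs ending to the right of y and
-- crosses the arcs ending between u and y.
increment : ∀ {n} → Vertex n → Vertex n × List (Vertex n) → ℕ × ℕ
increment u (y , vs) = count (y ≺?_) vs , count (λ v → (u ≺? v) ×-dec (v ≺? y)) vs

increment-↭ : ∀ {n} (u y : Vertex n) {vs ws} → vs ↭ ws → increment u (y , vs) ≡ increment u (y , ws)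
increment-↭ u y p = cong₂ _,_ (count-↭ _ p) (count-↭ _ p)

-- All other arcs start to the left of `u`, so the new arc is the second one of any crossing or
-- nesting it takes part in. The two definitions then reduce to conditions on the end of the other
-- arc.
exponents-∷ : ∀ {n} {u y : Vertex n} {us ys} → All (u ≻_) us → u ≺ y → Pointwise _≺_ us ys →
  exponents (zip (u ∷ us) (y ∷ ys)) ≡ increment u (y , ys) ⊕ exponents (zip us ys)
exponents-∷ {u = u} {y} {us} {ys} us≺u u≺y us≺ys = cong₂ _,_
  (trans (count-square-∷ nesting? (u , y) (zip us ys) (≺-irrefl ∘ proj₁ ∷ forward {Nesting} proj₁ us≺u us≺ys))
         (cong (ℕ._+ nestings (zip us ys)) (count-cong _ _ (nested us≺u us≺ys))))
  (trans (count-square-∷ crossing? (u , y) (zip us ys) (≺-irrefl ∘ proj₁ ∷ forward {Crossing} proj₁ us≺u us≺ys))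
         (cong (ℕ._+ crossings (zip us ys)) (count-cong _ _ (crossed us≺u us≺ys))))
  where
  forward : ∀ {P : Pred (Arc _ × Arc _) 0ℓ} → (∀ {a} → P ((u , y) , a) → u ≺ proj₁ a) →
    ∀ {us ys} → All (u ≻_) us → Pointwise _≺_ us ys → All (λ a → ¬ P ((u , y) , a)) (zip us ys)
  forward     f []       []       = []
  forward {P} f (p ∷ ps) (_ ∷ qs) = ≺-asym p ∘ f ∷ forward {P} f ps qs
  nested : ∀ {us ys} → All (u ≻_) us → Pointwise _≺_ us ys →
    Pointwise (λ a v → Nesting (a , (u , y)) ⇔ y ≺ v) (zip us ys) ys
  nested []       []       = []
  nested (p ∷ ps) (_ ∷ qs) = mk⇔ (λ (_ , _ , r) → r) (λ r → p , u≺y , r) ∷ nested ps qs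
  crossed : ∀ {us ys} → All (u ≻_) us → Pointwise _≺_ us ys →
    Pointwise (λ a v → Crossing (a , (u , y)) ⇔ (u ≺ v × v ≺ y)) (zip us ys) ys
  crossed []       []       = []
  crossed (p ∷ ps) (_ ∷ qs) = mk⇔ proj₂ (p ,_) ∷ crossed ps qs

-- An equality of lists, in order: `choices` keeps the ascending order of `vs`. In the induction a
-- first vertex `v` to the right of `u` lies between `u` and every later choice. A first vertex not
-- to the right of `u` affects no count.
map-increment-choices : ∀ {n} (u : Vertex n) {vs} → AllPairs _≺_ vs →
  map (increment u) (choices u vs) ≡ terms (count (u ≺?_) vs)
map-increment-choices u [] = refl
map-increment-choices u {v ∷ vs} (v≺ ∷ vs↗) = split (u ≺? v)
  where
  open ≡-Reasoning
  P? = λ (w : Vertex _ × List (Vertex _)) → u ≺? proj₁ w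
  v∷_ = map₂ (v ∷_)
  m = count (u ≺?_) vs
  right : ∀ {y ws} → (y , ws) ∈ choices u vs → v ≺ y
  right c∈ = All.lookup
    (All-resp-↭ (↭-sym (select-↭ (proj₁ (∈-filter⁻ P? {xs = select vs} c∈)))) v≺) (here refl)
  shifted : (f : ℕ × ℕ → ℕ × ℕ) →
    (∀ {c} → c ∈ choices u vs → increment u (v∷ c) ≡ f (increment u c)) →
    map (increment u) (filter P? (map v∷_ (select vs))) ≡ map f (terms m)
  shifted f eq = begin
    map (increment u) (filter P? (map v∷_ (select vs)))
      ≡⟨ cong (map (increment u)) (filter-map P? v∷_ (select vs)) ⟩
    map (increment u) (map v∷_ (choices u vs))    ≡⟨ map-∘ (choices u vs) ⟨
    map (increment u ∘ v∷_) (choices u vs)        ≡⟨ map-cong-local (All.tabulate eq) ⟩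
    map (f ∘ increment u) (choices u vs)          ≡⟨ map-∘ (choices u vs) ⟩
    map f (map (increment u) (choices u vs))      ≡⟨ cong (map f) (map-increment-choices u vs↗) ⟩
    map f (terms m)                               ∎
  split : Dec (u ≺ v) →
    map (increment u) (choices u (v ∷ vs)) ≡ terms (count (u ≺?_) (v ∷ vs))
  split (yes u≺v) = begin
    map (increment u) (choices u (v ∷ vs))
      ≡⟨ cong (map (increment u)) (filter-accept P? u≺v) ⟩
    increment u (v , vs) ∷ map (increment u) (filter P? (map v∷_ (select vs)))
      ≡⟨ cong₂ _∷_ (cong₂ _,_ none-left none-between)
                   (shifted (map₂ suc) λ {(y , ws)} c∈ → cong₂ _,_
                     (cong length (filter-reject (y ≺?_) (≺-asym (right c∈))))
                     (cong length (filter-accept (λ w → (u ≺? w) ×-dec (w ≺? y)) (u≺v , right c∈)))) ⟩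
    (m , 0) ∷ map (map₂ suc) (terms m)
      ≡⟨ terms-suc m ⟨
    terms (suc m)
      ≡⟨ cong (terms ∘ length) (filter-accept (u ≺?_) u≺v) ⟨
    terms (count (u ≺?_) (v ∷ vs)) ∎
    where
    -- The whole of `vs` lies to the right of `v`, hence also to the right of `u`.
    none-left : count (v ≺?_) vs ≡ m
    none-left = cong length (trans (filter-all (v ≺?_) v≺)
      (sym (filter-all (u ≺?_) (All.map (≺-trans u≺v) v≺))))
    none-between : count (λ w → (u ≺? w) ×-dec (w ≺? v)) vs ≡ 0
    none-between = count-none _ (All.map (λ v≺w (_ , w≺v) → ≺-asym v≺w w≺v) v≺)
  split (no ¬u≺v) = begin
    map (increment u) (choices u (v ∷ vs))
      ≡⟨ cong (map (increment u)) (filter-reject P? ¬u≺v) ⟩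
    map (increment u) (filter P? (map v∷_ (select vs)))
      ≡⟨ shifted id (λ {(y , ws)} c∈ → cong₂ _,_
           (cong length (filter-reject (y ≺?_) (≺-asym (right c∈))))
           (cong length (filter-reject (λ w → (u ≺? w) ×-dec (w ≺? y)) (¬u≺v ∘ proj₁)))) ⟩
    map id (terms m)
      ≡⟨ map-id (terms m) ⟩
    terms m
      ≡⟨ cong (terms ∘ length) (filter-reject (u ≺?_) ¬u≺v) ⟨
    terms (count (u ≺?_) (v ∷ vs)) ∎

height : ∀ {n} → List (Vertex n) → List (Vertex n) → Vertex n → ℕ
height us vs v = count (v ≺?_) vs ∸ count (v ≺?_) us

-- The choice at `u` contributes a term of its factor, and the remaining heights are the same for
-- every choice, so the remaining factors can be split off. Equal lengths matter in the base case: a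
-- leftover right endpoint would allow no matching, while the empty product has one term.
matchings-exponents : ∀ {n} {us vs : List (Vertex n)} → AllPairs _≻_ us → AllPairs _≺_ vs →
  length us ≡ length vs →
  map (exponents ∘ zip us) (matchings us vs) ↭ productTerms (map (height us vs) us)
matchings-exponents {us = []} {[]} [] _ _ = refl
matchings-exponents {us = u ∷ us} {vs} (us≺u ∷ us↘) vs↗ eq = begin
  map (exponents ∘ zip (u ∷ us)) (concatMap extensions (choices u vs))
    ≡⟨ map-concatMap (exponents ∘ zip (u ∷ us)) extensions (choices u vs) ⟩
  concatMap (map (exponents ∘ zip (u ∷ us)) ∘ extensions) (choices u vs)
    ↭⟨ concatMap-cong-↭ (All.tabulate step) ⟩
  concatMap ((λ t → map (t ⊕_) (productTerms ms)) ∘ increment u) (choices u vs)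
    ≡⟨ concatMap-map (λ t → map (t ⊕_) (productTerms ms)) (increment u) (choices u vs) ⟨
  concatMap (λ t → map (t ⊕_) (productTerms ms)) (map (increment u) (choices u vs))
    ≡⟨ cong (concatMap (λ t → map (t ⊕_) (productTerms ms)))
            (trans (map-increment-choices u vs↗) (cong terms top)) ⟩
  productTerms (map (height (u ∷ us) vs) (u ∷ us)) ∎
  where
  open PermutationReasoning
  extensions : Vertex _ × List (Vertex _) → List (List (Vertex _))
  extensions (y , vs′) = map (y ∷_) (matchings us vs′)
  ms = map (height (u ∷ us) vs) us
  -- `u` is the rightmost left endpoint, so nothing is subtracted in its height.
  top : count (u ≺?_) vs ≡ height (u ∷ us) vs u
  top = cong (count (u ≺?_) vs ∸_) (sym (count-none (u ≺?_) (≺-irrefl ∷ All.map ≺-asym us≺u)))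
  step : ∀ {c} → c ∈ choices u vs →
    map (exponents ∘ zip (u ∷ us)) (extensions c) ↭ map (increment u c ⊕_) (productTerms ms)
  step {y , vs′} c∈ with ∈-filter⁻ (λ (v , _) → u ≺? v) {xs = select vs} c∈
  ... | y∈ , u≺y = begin
    map (exponents ∘ zip (u ∷ us)) (map (y ∷_) (matchings us vs′))
      ≡⟨ map-∘ (matchings us vs′) ⟨
    map (exponents ∘ zip (u ∷ us) ∘ (y ∷_)) (matchings us vs′)
      ≡⟨ map-cong-local (All.tabulate split) ⟩
    map ((increment u (y , vs′) ⊕_) ∘ exponents ∘ zip us) (matchings us vs′)
      ≡⟨ map-∘ (matchings us vs′) ⟩
    map (increment u (y , vs′) ⊕_) (map (exponents ∘ zip us) (matchings us vs′))
      ↭⟨ Perm.map⁺ _ (matchings-exponents us↘ (AllPairs-select vs↗ y∈)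
           (ℕ.suc-injective (trans eq (sym (↭-length (select-↭ y∈)))))) ⟩
    map (increment u (y , vs′) ⊕_) (productTerms (map (height us vs′) us))
      ≡⟨ cong (map (increment u (y , vs′) ⊕_) ∘ productTerms)
              (map-cong-local (All.map same us≺u)) ⟩
    map (increment u (y , vs′) ⊕_) (productTerms ms) ∎
    where
    split : ∀ {ys} → ys ∈ matchings us vs′ →
      exponents (zip (u ∷ us) (y ∷ ys)) ≡ increment u (y , vs′) ⊕ exponents (zip us ys)
    split {ys} ys∈ with matchings-sound us ys∈
    ... | us≺ys , ys↭vs′ = trans (exponents-∷ us≺u u≺y us≺ys)
      (cong (_⊕ exponents (zip us ys)) (increment-↭ u y ys↭vs′))
    -- For `v` to the left of `u`, removing `y` and `u` lowers both counts in the height by exactly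
    -- one.
    same : ∀ {v} → v ≺ u → height us vs′ v ≡ height (u ∷ us) vs v
    same {v} v≺u = sym (cong₂ _∸_
      (trans (count-↭ (v ≺?_) (↭-sym (select-↭ y∈)))
             (cong length (filter-accept (v ≺?_) (≺-trans v≺u u≺y))))
      (cong length (filter-accept (v ≺?_) v≺u)))

-- Replacing `k` by `m ∸ k` interchanges the two exponents of a term of `suc m`.
∈-terms-swap : ∀ {m t} → t ∈ terms m → swap t ∈ terms m
∈-terms-swap {suc m} t∈ with ∈-map⁻ _ t∈
... | k , k∈ , refl = subst (λ l → (l , m ∸ k) ∈ terms (suc m))
  (ℕ.m∸[m∸n]≡n (ℕ.≤-pred (∈-upTo⁻ k∈)))
  (∈-map⁺ (λ k → m ∸ k , k) (∈-upTo⁺ (s≤s (ℕ.m∸n≤m m k))))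

terms-swap : ∀ m → map swap (terms m) ↭ terms m
terms-swap m = unique∧set⇒↭ (Unique.map⁺ (cong swap) terms!) terms! to from
  where
  terms! : Unique (terms m)
  terms! = Unique.map⁺ (cong proj₂) (Unique.upTo⁺ m)
  to : ∀ {t} → t ∈ map swap (terms m) → t ∈ terms m
  to t∈ with ∈-map⁻ swap t∈
  ... | _ , s∈ , refl = ∈-terms-swap s∈
  from : ∀ {t} → t ∈ terms m → t ∈ map swap (terms m)
  from t∈ = ∈-map⁺ swap (∈-terms-swap t∈)

productTerms-swap : ∀ ms → map swap (productTerms ms) ↭ productTerms ms
productTerms-swap []       = refl
productTerms-swap (m ∷ ms) = begin
  map swap (concatMap (λ t → map (t ⊕_) (productTerms ms)) (terms m))
    ≡⟨ map-concatMap swap _ (terms m) ⟩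
  concatMap (λ t → map swap (map (t ⊕_) (productTerms ms))) (terms m)
    ↭⟨ concatMap-cong-↭ (All.universal step (terms m)) ⟩
  concatMap (λ t → map (swap t ⊕_) (productTerms ms)) (terms m)
    ≡⟨ concatMap-map (λ t → map (t ⊕_) (productTerms ms)) swap (terms m) ⟨
  concatMap (λ t → map (t ⊕_) (productTerms ms)) (map swap (terms m))
    ↭⟨ concatMap⁺-↭ _ (terms-swap m) ⟩
  concatMap (λ t → map (t ⊕_) (productTerms ms)) (terms m) ∎
  where
  open PermutationReasoning
  step : ∀ t → map swap (map (t ⊕_) (productTerms ms)) ↭ map (swap t ⊕_) (productTerms ms)
  step t = begin
    map swap (map (t ⊕_) (productTerms ms))        ≡⟨ map-∘ (productTerms ms) ⟨
    map ((swap t ⊕_) ∘ swap) (productTerms ms)     ≡⟨ map-∘ (productTerms ms) ⟩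
    map (swap t ⊕_) (map swap (productTerms ms))   ↭⟨ Perm.map⁺ _ (productTerms-swap ms) ⟩
    map (swap t ⊕_) (productTerms ms)              ∎

-- Linked cycles

AllPairs-map-∈ : {R S : Rel A 0ℓ} → (∀ {x y} → x ∈ xs → y ∈ xs → R x y → S x y) →
  AllPairs R xs → AllPairs S xs
AllPairs-map-∈ f []         = []
AllPairs-map-∈ f (Rx ∷ Rxs) =
  All.tabulate (λ y∈ → f (here refl) (there y∈) (All.lookup Rx y∈))
  ∷ AllPairs-map-∈ (λ x∈ y∈ → f (there x∈) (there y∈)) Rxs

Unique-++⁻ : (xs : List A) → Unique (xs ++ ys) → Unique xs × Unique ys × Disjoint xs ys
Unique-++⁻ []       ys!          = [] , ys! , λ ()
Unique-++⁻ (x ∷ xs) (x∉ ∷ xsys!) with Unique-++⁻ xs xsys!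
... | xs! , ys! , disjoint = All.++⁻ˡ xs x∉ ∷ xs! , ys! , λ where
  (here refl , x∈ys) → All.lookup (All.++⁻ʳ xs x∉) x∈ys refl
  (there z∈xs , z∈ys) → disjoint (z∈xs , z∈ys)

Unique-concatMap⁻ : (f : A → List B) (xs : List A) → Unique (concatMap f xs) → All (Unique ∘ f) xs
Unique-concatMap⁻ f []       _ = []
Unique-concatMap⁻ f (x ∷ xs) u with Unique-++⁻ (f x) u
... | fx! , rest! , _ = fx! ∷ Unique-concatMap⁻ f xs rest!

Unique-concatMap-injective : (f : A → List B) → Unique (concatMap f xs) →
  ∀ {x y z} → x ∈ xs → y ∈ xs → z ∈ f x → z ∈ f y → x ≡ y
Unique-concatMap-injective {xs = x ∷ xs} f u p q z∈fx z∈fy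
  with Unique-++⁻ (f x) u
... | _ , rest! , disjoint with p | q
... | here refl | here refl = refl
... | here refl | there q   = contradiction (z∈fx , ∈-concat⁺′ z∈fy (∈-map⁺ f q)) disjoint
... | there p   | here refl = contradiction (z∈fy , ∈-concat⁺′ z∈fx (∈-map⁺ f p)) disjoint
... | there p   | there q   = Unique-concatMap-injective f rest! p q z∈fx z∈fy

Unique-map-injective : (f : A → B) → Unique (map f xs) → x ∈ xs → y ∈ xs → f x ≡ f y → x ≡ y
Unique-map-injective f u x∈ y∈ eq with ∈-AllPairs₂ (AllPairs.map⁻ u) x∈ y∈
... | inj₁ x≡y        = x≡y
... | inj₂ (inj₁ x≢y) = contradiction eq x≢y
... | inj₂ (inj₂ y≢x) = contradiction (sym eq) y≢x

∈-concatMap⁻′ : (f : A → List B) (xs : List A) {y : B} → y ∈ concatMap f xs → ∃ λ x → x ∈ xs × y ∈ f x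
∈-concatMap⁻′ f xs y∈ with ∈-concat⁻′ (map f xs) y∈
... | _ , y∈fx , fx∈ with ∈-map⁻ f fx∈
... | x , x∈ , refl = x , x∈ , y∈fx

∈-⋃⁺ : ∀ {n} {i : Fin n} {E Es} → E ∈ Es → i ∈ₛ E → i ∈ₛ ⋃ Es
∈-⋃⁺ (here refl) i∈E = x∈p∪q⁺ (inj₁ i∈E)
∈-⋃⁺ (there E∈)  i∈E = x∈p∪q⁺ (inj₂ (∈-⋃⁺ E∈ i∈E))

∈-⋃⁻ : ∀ {n} {i : Fin n} Es → i ∈ₛ ⋃ Es → ∃ λ E → E ∈ Es × i ∈ₛ E
∈-⋃⁻ []       i∈ = contradiction i∈ ∉⊥
∈-⋃⁻ (E ∷ Es) i∈ with x∈p∪q⁻ E (⋃ Es) i∈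
... | inj₁ i∈E = E , here refl , i∈E
... | inj₂ i∈⋃ with ∈-⋃⁻ Es i∈⋃
... | F , F∈ , i∈F = F , there F∈ , i∈F

Cycle : ℕ → Set
Cycle n = List⁺ (Fin n)

minima nonMinima : ∀ {n} → List (Cycle n) → List (Fin n)
minima  = map List⁺.head
nonMinima = concatMap List⁺.tail

∈-block⁺ : ∀ {n} {i : Fin n} {c} → i ∈ List⁺.toList c → i ∈ₛ block c
∈-block⁺ {i = i} i∈c = ∈-⋃⁺ (∈-map⁺ ⁅_⁆ i∈c) (x∈⁅x⁆ i)

∈-block⁻ : ∀ {n} {i : Fin n} {c} → i ∈ₛ block c → i ∈ List⁺.toList c
∈-block⁻ {c = c} i∈ with ∈-⋃⁻ (map ⁅_⁆ (List⁺.toList c)) i∈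
... | _ , E∈ , i∈E with ∈-map⁻ ⁅_⁆ E∈
... | j , j∈c , refl = subst (_∈ _) (sym (x∈⁅y⁆⇒x≡y j i∈E)) j∈c

∈-nonMinima⁺ : ∀ {n} {i : Fin n} {c cs} → c ∈ cs → i ∈ List⁺.tail c → i ∈ nonMinima cs
∈-nonMinima⁺ c∈ i∈c = ∈-concat⁺′ i∈c (∈-map⁺ List⁺.tail c∈)

∈-nonMinima⁻ : ∀ {n} {i : Fin n} cs → i ∈ nonMinima cs → ∃ λ c → c ∈ cs × i ∈ List⁺.tail c
∈-nonMinima⁻ cs = ∈-concatMap⁻′ List⁺.tail cs

IsMin-unique : ∀ {n} {i j : Fin n} {E} → IsMin i E → IsMin j E → i ≡ j
IsMin-unique (i∈E , i≤) (j∈E , j≤) = Fin.≤-antisym (i≤ j∈E) (j≤ i∈E)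

head-IsMin : ∀ {n} {c : Cycle n} → IsCycle c → IsMin (List⁺.head c) (block c)
head-IsMin {c = i ∷ is} (i< , _) = ∈-block⁺ {c = i ∷ is} (here refl) , λ j∈ → least (∈-block⁻ {c = i ∷ is} j∈)
  where
  least : ∀ {j} → j ∈ i ∷ is → i Fin.≤ j
  least (here refl) = ℕ.≤-refl
  least (there j∈)  = ℕ.<⇒≤ (All.lookup i< j∈)

tail-¬IsMin : ∀ {n} {c : Cycle n} {i} → IsCycle c → i ∈ List⁺.tail c → ¬ IsMin i (block c)
tail-¬IsMin {c = c} isC i∈ min =
  Fin.<⇒≢ (All.lookup (proj₁ isC) i∈) (IsMin-unique (head-IsMin {c = c} isC) min)

size>1 : ∀ {n} {c : Cycle n} {i} → IsCycle c → i ∈ List⁺.tail c → ∣ block c ∣ ℕ.> 1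
size>1 {c = j ∷ js} {i} (j< , _) i∈ = subst (ℕ._< ∣ block (j ∷ js) ∣) (∣⁅x⁆∣≡1 j) (p⊂q⇒∣p∣<∣q∣
  ( (λ k∈ → subst (_∈ₛ block (j ∷ js)) (sym (x∈⁅y⁆⇒x≡y j k∈)) (∈-block⁺ {c = j ∷ js} (here refl)))
  , i , ∈-block⁺ {c = j ∷ js} (there i∈)
  , λ i∈⁅j⁆ → Fin.<⇒≢ (All.lookup j< i∈) (sym (x∈⁅y⁆⇒x≡y j i∈⁅j⁆))))

singleton-size : ∀ {n} (i : Fin n) → ∣ block (i ∷ []) ∣ ≡ 1
singleton-size i = trans (cong ∣_∣ (∪-identityʳ ⁅ i ⁆)) (∣⁅x⁆∣≡1 i)

-- An element-wise description of linked cycles: near disjointness says that every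
-- element is the minimum of at most one cycle and a non-minimal element of at most
-- one cycle, and that the cycle of which a doubly covered element is the minimum
-- is not a singleton.
record Proper {n : ℕ} (cs : List (Cycle n)) : Set where
  field
    cyc     : All IsCycle cs
    minima!   : Unique (minima cs)
    nonMinima!  : Unique (nonMinima cs)
    cover   : ∀ i → i ∈ minima cs ⊎ i ∈ nonMinima cs
    bigMins : ∀ {i} → (i ∷ []) ∈ cs → i ∉ nonMinima cs

  sameMin : ∀ {c d} → c ∈ cs → d ∈ cs → List⁺.head c ≡ List⁺.head d → c ≡ d
  sameMin = Unique-map-injective List⁺.head minima!

linked⇒proper : ∀ {n} {cs : List (Cycle n)} → All IsCycle cs → IsLinkedPartition (map block cs) → Proper cs
linked⇒proper {n} {cs} cyc lp = record
  { cyc     = cyc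
  ; minima!   = AllPairs.map⁺ (AllPairs-map-∈ distinctMins blocks!)
  ; nonMinima!  = Unique.concat⁺ (All.map⁺ (All.map proj₂ cyc))
                             (AllPairs.map⁺ (AllPairs-map-∈ disjointTails blocks!))
  ; cover   = cover
  ; bigMins = bigMins
  }
  where
  open IsLinkedPartition lp
  -- `linked` speaks of distinct blocks only. By `distinct`, cycles at different positions of the
  -- list have distinct blocks.
  blocks! : AllPairs (λ c d → block c ≢ block d) cs
  blocks! = AllPairs.map⁻ distinct
  near : ∀ {c d} → c ∈ cs → d ∈ cs → block c ≢ block d → NearlyDisjoint (block c) (block d)
  near c∈ d∈ = linked (∈-map⁺ block c∈) (∈-map⁺ block d∈)
  distinctMins : ∀ {c d} → c ∈ cs → d ∈ cs → block c ≢ block d → List⁺.head c ≢ List⁺.head d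
  distinctMins {c} {d} c∈ d∈ c≢d refl
    with near c∈ d∈ c≢d (List⁺.head c) (∈-block⁺ {c = c} (here refl)) (∈-block⁺ {c = d} (here refl))
  ... | inj₁ (_ , _ , ¬min) = ¬min (head-IsMin {c = d} (All.lookup cyc d∈))
  ... | inj₂ (_ , _ , ¬min) = ¬min (head-IsMin {c = c} (All.lookup cyc c∈))
  disjointTails : ∀ {c d} → c ∈ cs → d ∈ cs → block c ≢ block d → Disjoint (List⁺.tail c) (List⁺.tail d)
  disjointTails {c} {d} c∈ d∈ c≢d {i} (i∈c , i∈d)
    with near c∈ d∈ c≢d i (∈-block⁺ {c = c} (there i∈c)) (∈-block⁺ {c = d} (there i∈d))
  ... | inj₁ (min , _) = tail-¬IsMin {c = c} (All.lookup cyc c∈) i∈c min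
  ... | inj₂ (min , _) = tail-¬IsMin {c = d} (All.lookup cyc d∈) i∈d min
  cover : ∀ i → i ∈ minima cs ⊎ i ∈ nonMinima cs
  cover i with ∈-⋃⁻ (map block cs) (subst (i ∈ₛ_) (sym union) ∈⊤)
  ... | _ , E∈ , i∈E with ∈-map⁻ block E∈
  ... | c , c∈ , refl with ∈-block⁻ {c = c} i∈E
  ... | here refl = inj₁ (∈-map⁺ List⁺.head c∈)
  ... | there i∈c = inj₂ (∈-nonMinima⁺ c∈ i∈c)
  -- A cycle with `i` in its tail has a minimum below `i`, which does not belong to the block of `i`
  -- alone.
  singleton≢ : ∀ {i d} → d ∈ cs → i ∈ List⁺.tail d → block (i ∷ []) ≢ block d
  singleton≢ {i} {d} d∈ i∈d eq
    with ∈-block⁻ {c = i ∷ []} (subst (List⁺.head d ∈ₛ_) (sym eq) (∈-block⁺ {c = d} (here refl)))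
  ... | here refl = Fin.<-irrefl refl (All.lookup (proj₁ (All.lookup cyc d∈)) i∈d)
  bigMins : ∀ {i} → (i ∷ []) ∈ cs → i ∉ nonMinima cs
  bigMins {i} i∈ i∈nonMin with ∈-nonMinima⁻ cs i∈nonMin
  ... | d , d∈ , i∈d
    with near i∈ d∈ (singleton≢ d∈ i∈d) i (∈-block⁺ {c = i ∷ []} (here refl)) (∈-block⁺ {c = d} (there i∈d))
  ... | inj₁ (_ , >1 , _) = ℕ.<-irrefl (sym (singleton-size i)) >1
  ... | inj₂ (min , _)    = tail-¬IsMin {c = d} (All.lookup cyc d∈) i∈d min

-- A shared element that is minimal in both cycles, or non-minimal in both, forces the cycles to
-- coincide. In the mixed case `bigMins` supplies the required size of the block.
proper⇒linked : ∀ {n} {cs : List (Cycle n)} → Proper cs → IsLinkedPartition (map block cs)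
proper⇒linked {n} {cs} proper = record
  { distinct = AllPairs.map⁺ (AllPairs-map-∈ distinctBlocks (AllPairs.map⁻ minima!))
  ; nonempty = All.map⁺ (All.universal (λ c → List⁺.head c , ∈-block⁺ {c = c} (here refl)) cs)
  ; union    = ⊆-antisym ⊆⊤ (λ {i} _ → covered (cover i))
  ; linked   = linked
  }
  where
  open Proper proper
  isMin : ∀ {c} → c ∈ cs → IsMin (List⁺.head c) (block c)
  isMin {c} c∈ = head-IsMin {c = c} (All.lookup cyc c∈)
  distinctBlocks : ∀ {c d} → c ∈ cs → d ∈ cs → List⁺.head c ≢ List⁺.head d → block c ≢ block d
  distinctBlocks {c} {d} c∈ d∈ c≢d eq =
    c≢d (IsMin-unique (isMin c∈) (subst (IsMin (List⁺.head d)) (sym eq) (isMin d∈)))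
  covered : ∀ {i} → i ∈ minima cs ⊎ i ∈ nonMinima cs → i ∈ₛ ⋃ (map block cs)
  covered (inj₁ i∈) with ∈-map⁻ List⁺.head i∈
  ... | c , c∈ , refl = ∈-⋃⁺ (∈-map⁺ block c∈) (∈-block⁺ {c = c} (here refl))
  covered (inj₂ i∈) with ∈-nonMinima⁻ cs i∈
  ... | c , c∈ , i∈c = ∈-⋃⁺ (∈-map⁺ block c∈) (∈-block⁺ {c = c} (there i∈c))
  big : ∀ {c d} → c ∈ cs → d ∈ cs → List⁺.head c ∈ List⁺.tail d → ∣ block c ∣ ℕ.> 1
  big {i ∷ []}    c∈ d∈ i∈d = contradiction (∈-nonMinima⁺ d∈ i∈d) (bigMins c∈)
  big {i ∷ j ∷ _} c∈ d∈ i∈d = size>1 {c = i ∷ j ∷ _} (All.lookup cyc c∈) (here refl)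
  linked : ∀ {E F} → E ∈ map block cs → F ∈ map block cs → E ≢ F → NearlyDisjoint E F
  linked E∈ F∈ E≢F i i∈E i∈F with ∈-map⁻ block E∈ | ∈-map⁻ block F∈
  ... | c , c∈ , refl | d , d∈ , refl with ∈-block⁻ {c = c} i∈E | ∈-block⁻ {c = d} i∈F
  ... | here eq   | here eq′  = contradiction (cong block (sameMin c∈ d∈ (trans (sym eq) eq′))) E≢F
  ... | here refl | there i∈d =
    inj₁ (isMin c∈ , big c∈ d∈ i∈d , tail-¬IsMin {c = d} (All.lookup cyc d∈) i∈d)
  ... | there i∈c | here refl =
    inj₂ (isMin d∈ , big d∈ c∈ i∈c , tail-¬IsMin {c = c} (All.lookup cyc c∈) i∈c)
  ... | there i∈c | there i∈d =
    contradiction (cong block (Unique-concatMap-injective List⁺.tail nonMinima! c∈ d∈ i∈c i∈d)) E≢F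

-- Vertex labelings

-- The role of an element: a singleton cycle, the minimum of a cycle of size k + 2
-- (opener k), a non-minimal element (closer), or both of the latter (transient k).
data Kind : Set where
  singleton closer : Kind
  opener transient : ℕ → Kind

kindLabels : ∀ {n} → Fin n → Kind → List (Label n)
kindLabels i singleton     = isolated (i , 1) ∷ []
kindLabels i closer        = endpoint (i , 0) ∷ []
kindLabels i (opener k)    = map (λ j → endpoint (i , j)) (upFrom1 (suc k))
kindLabels i (transient k) = map (λ j → endpoint (i , j)) (0 ∷ upFrom1 (suc k))

-- The kind can be decoded: the first label and whether others follow give its constructor, and the
-- number of labels gives its parameter.
kindLabels-injective : ∀ {n} (i : Fin n) {κ κ′} → kindLabels i κ ≡ kindLabels i κ′ → κ ≡ κ′
kindLabels-injective i {κ} {κ′} eq =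
  trans (sym (kind-kindLabels κ)) (trans (cong kind eq) (kind-kindLabels κ′))
  where
  kind : ∀ {n} → List (Label n) → Kind
  kind (endpoint (_ , zero) ∷ [])         = closer
  -- After the label with superscript 0 come the superscripts 1 to k + 1. For an opener, whose first
  -- superscript is 1, exactly k labels remain instead.
  kind (endpoint (_ , zero) ∷ ls@(_ ∷ _)) = transient (length ls ∸ 1)
  kind (endpoint (_ , suc _) ∷ ls)        = opener (length ls)
  kind _                                  = singleton
  length-labels : ∀ k → length (map {B = Label _} (λ j → endpoint (i , j)) (map suc (applyUpTo suc k))) ≡ k
  length-labels k = trans (length-map _ (map suc (applyUpTo suc k)))
    (trans (length-map suc (applyUpTo suc k)) (length-applyUpTo suc k))
  kind-kindLabels : ∀ κ → kind (kindLabels i κ) ≡ κ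
  kind-kindLabels singleton     = refl
  kind-kindLabels closer        = refl
  kind-kindLabels (opener k)    = cong opener (length-labels k)
  kind-kindLabels (transient k) = cong transient (length-labels k)

vertex-kindLabels : ∀ {n} (i : Fin n) κ → All (λ l → proj₁ (vertex l) ≡ i) (kindLabels i κ)
vertex-kindLabels i singleton     = refl ∷ []
vertex-kindLabels i closer        = refl ∷ []
vertex-kindLabels i (opener k)    = All.map⁺ (All.universal (λ _ → refl) _)
vertex-kindLabels i (transient k) = All.map⁺ (All.universal (λ _ → refl) _)

filter-concatMap : (f : A → List B) (key : B → A) (_≟_ : (x y : A) → Dec (x ≡ y)) →
  All (λ x → All (λ y → key y ≡ x) (f x)) xs → Unique xs → x ∈ xs →
  filter (λ y → key y ≟ x) (concatMap f xs) ≡ f x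
filter-concatMap {xs = x ∷ xs} f key _≟_ (keys ∷ keyss) (x∉ ∷ _) (here refl) = begin
  filter P? (f x ++ concatMap f xs)           ≡⟨ filter-++ P? (f x) _ ⟩
  filter P? (f x) ++ filter P? (concatMap f xs) ≡⟨ cong₂ _++_ (filter-all P? keys) (filter-none P? others) ⟩
  f x ++ []                                   ≡⟨ ++-identityʳ (f x) ⟩
  f x                                         ∎
  where
  open ≡-Reasoning
  P? = λ y → key y ≟ x
  others : All (λ y → key y ≢ x) (concatMap f xs)
  others = All.concat⁺ (All.map⁺ (All.zipWith
    (λ (x≢z , ks) → All.map (λ k≡z k≡x → x≢z (trans (sym k≡x) k≡z)) ks) (x∉ , keyss)))
filter-concatMap {xs = z ∷ xs} {x = x} f key _≟_ (keys ∷ keyss) (z∉ ∷ xs!) (there x∈) = begin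
  filter P? (f z ++ concatMap f xs)             ≡⟨ filter-++ P? (f z) _ ⟩
  filter P? (f z) ++ filter P? (concatMap f xs)
    ≡⟨ cong (_++ filter P? (concatMap f xs)) (filter-none P?
         (All.map (λ k≡z k≡x → All.lookup z∉ x∈ (trans (sym k≡z) k≡x)) keys)) ⟩
  filter P? (concatMap f xs)                    ≡⟨ filter-concatMap f key _≟_ keyss xs! x∈ ⟩
  f x                                           ∎
  where
  open ≡-Reasoning
  P? = λ y → key y ≟ x

kindLabeling : ∀ {n} → (Fin n → Kind) → List (Label n)
kindLabeling {n} κ = concatMap (λ i → kindLabels i (κ i)) (allFin n)

-- Every label names its element, so filtering by `i` cuts the labels of `i` out of the whole
-- labeling.
kindLabeling-injective : ∀ {n} (κ κ′ : Fin n → Kind) → kindLabeling κ ≡ kindLabeling κ′ → ∀ i → κ i ≡ κ′ i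
kindLabeling-injective {n} κ κ′ eq i = kindLabels-injective i
  (trans (sym (labelsAt κ)) (trans (cong (filter (λ l → proj₁ (vertex l) Fin.≟ i)) eq) (labelsAt κ′)))
  where
  labelsAt : (κ : Fin n → Kind) →
    filter (λ l → proj₁ (vertex l) Fin.≟ i) (kindLabeling κ) ≡ kindLabels i (κ i)
  labelsAt κ = filter-concatMap (λ i → kindLabels i (κ i)) (proj₁ ∘ vertex) Fin._≟_
    (All.universal (λ i → vertex-kindLabels i (κ i)) _) (Unique.allFin⁺ n) (∈-allFin i)

-- `nothing` and `just 0` both mean that there are no left endpoints, but only `just 0` means that a
-- cycle, a singleton, has this minimum.
tailLength : Kind → Maybe ℕ
tailLength singleton     = just 0
tailLength closer        = nothing
tailLength (opener k)    = just (suc k)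
tailLength (transient k) = just (suc k)

closes : Kind → Bool
closes singleton     = false
closes closer        = true
closes (opener k)    = false
closes (transient k) = true

Opens : ∀ {n} → List (Cycle n) → Fin n → Maybe ℕ → Set
Opens cs i nothing  = i ∉ minima cs
Opens cs i (just k) = ∃ λ is → (i ∷ is) ∈ cs × length is ≡ k

Closes : ∀ {n} → List (Cycle n) → Fin n → Bool → Set
Closes cs i true  = i ∈ nonMinima cs
Closes cs i false = i ∉ nonMinima cs

HasKind : ∀ {n} → List (Cycle n) → Fin n → Kind → Set
HasKind cs i κ = Opens cs i (tailLength κ) × Closes cs i (closes κ)

kindOf : ∀ {n} {cs : List (Cycle n)} → Proper cs → ∀ i → ∃ (HasKind cs i)
kindOf {cs = cs} proper i with Any.any? (i Fin.≟_) (minima cs) | Any.any? (i Fin.≟_) (nonMinima cs)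
... | no i∉ | yes i∈′ = closer , i∉ , i∈′
... | no i∉ | no i∉′ with Proper.cover proper i
...   | inj₁ i∈  = contradiction i∈ i∉
...   | inj₂ i∈′ = contradiction i∈′ i∉′
kindOf {cs = cs} proper i | yes i∈ | d with ∈-map⁻ List⁺.head i∈
kindOf proper i | yes i∈ | yes i∈′ | (i ∷ [])     , c∈ , refl = contradiction i∈′ (Proper.bigMins proper c∈)
kindOf proper i | yes i∈ | yes i∈′ | (i ∷ j ∷ js) , c∈ , refl = transient (length js) , (j ∷ js , c∈ , refl) , i∈′
kindOf proper i | yes i∈ | no i∉′  | (i ∷ [])     , c∈ , refl = singleton , ([] , c∈ , refl) , i∉′
kindOf proper i | yes i∈ | no i∉′  | (i ∷ j ∷ js) , c∈ , refl = opener (length js) , (j ∷ js , c∈ , refl) , i∉′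

filter-key-unique : (f : A → B) (_≟_ : (x y : B) → Dec (x ≡ y)) → Unique (map f xs) → x ∈ xs →
  filter (λ z → f z ≟ f x) xs ≡ x ∷ []
filter-key-unique {x = x} f _≟_ (fx∉ ∷ _) (here refl) = trans
  (filter-accept (λ z → f z ≟ f x) refl)
  (cong (x ∷_) (filter-none (λ z → f z ≟ f x) (All.map (_∘ sym) (All.map⁻ fx∉))))
filter-key-unique {x = x} f _≟_ (fz∉ ∷ fxs!) (there x∈) = trans
  (filter-reject (λ z → f z ≟ f x) (All.lookup (All.map⁻ fz∉) x∈))
  (filter-key-unique f _≟_ fxs! x∈)

count-≟-∈ : ∀ {n} {i : Fin n} {is} → Unique is → i ∈ is → count (Fin._≟ i) is ≡ 1
count-≟-∈ {is = is} is! i∈ =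
  cong length (filter-key-unique {xs = is} id Fin._≟_ (subst Unique (sym (map-id is)) is!) i∈)

count-≟-∉ : ∀ {n} {i : Fin n} {is} → i ∉ is → count (Fin._≟ i) is ≡ 0
count-≟-∉ {i = i} i∉ = count-none (Fin._≟ i) (All.tabulate λ { j∈ refl → i∉ j∈ })

-- The minimum of a cycle does not recur in its tail and the tail has no repetitions, so each block
-- containing `i` contributes exactly one to the right-hand side.
count-blocks : ∀ {n} (i : Fin n) {cs : List (Cycle n)} → All IsCycle cs →
  count (λ c → i ∈ₛ? block c) cs
    ≡ count (λ c → List⁺.head c Fin.≟ i) cs ℕ.+ count (Fin._≟ i) (nonMinima cs)
count-blocks i [] = refl
count-blocks i {c ∷ cs} (isC ∷ cyc) = begin
  count covers (c ∷ cs)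
    ≡⟨ count-++ covers (c ∷ []) cs ⟩
  count covers (c ∷ []) ℕ.+ count covers cs
    ≡⟨ cong₂ ℕ._+_ (one c isC) (count-blocks i cyc) ⟩
  (count starts (c ∷ []) ℕ.+ count (Fin._≟ i) (List⁺.tail c))
    ℕ.+ (count starts cs ℕ.+ count (Fin._≟ i) (nonMinima cs))
    ≡⟨ interchange ℕ.+-commutativeSemigroup (count starts (c ∷ [])) _ (count starts cs) _ ⟩
  (count starts (c ∷ []) ℕ.+ count starts cs)
    ℕ.+ (count (Fin._≟ i) (List⁺.tail c) ℕ.+ count (Fin._≟ i) (nonMinima cs))
    ≡⟨ cong₂ ℕ._+_ (count-++ starts (c ∷ []) cs) (count-++ (Fin._≟ i) (List⁺.tail c) (nonMinima cs)) ⟨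
  count starts (c ∷ cs) ℕ.+ count (Fin._≟ i) (nonMinima (c ∷ cs)) ∎
  where
  open ≡-Reasoning
  covers : Decidable (λ c → i ∈ₛ block c)
  covers c = i ∈ₛ? block c
  starts : Decidable (λ c → List⁺.head c ≡ i)
  starts c = List⁺.head c Fin.≟ i
  one : ∀ c → IsCycle c → count covers (c ∷ []) ≡ count starts (c ∷ []) ℕ.+ count (Fin._≟ i) (List⁺.tail c)
  one (j ∷ js) (j< , js!) = split (j Fin.≟ i) (Any.any? (i Fin.≟_) js)
    where
    combine : ∀ {a b c} → count covers ((j ∷ js) ∷ []) ≡ a ℕ.+ b →
      count starts ((j ∷ js) ∷ []) ≡ a → c ≡ b → count covers ((j ∷ js) ∷ []) ≡ count starts ((j ∷ js) ∷ []) ℕ.+ c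
    combine eq eq₁ eq₂ = trans eq (sym (cong₂ ℕ._+_ eq₁ eq₂))
    split : Dec (j ≡ i) → Dec (i ∈ js) →
      count covers ((j ∷ js) ∷ []) ≡ count starts ((j ∷ js) ∷ []) ℕ.+ count (Fin._≟ i) js
    split (yes refl) _ = combine
      (cong length (filter-accept covers {xs = []} (∈-block⁺ {c = j ∷ js} (here refl))))
      (cong length (filter-accept starts {x = j ∷ js} {xs = []} refl))
      (count-≟-∉ (λ i∈ → Fin.<-irrefl refl (All.lookup j< i∈)))
    split (no j≢i) (yes i∈) = combine
      (cong length (filter-accept covers {xs = []} (∈-block⁺ {c = j ∷ js} (there i∈))))
      (cong length (filter-reject starts {x = j ∷ js} {xs = []} j≢i))
      (count-≟-∈ js! i∈)
    split (no j≢i) (no i∉) = combine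
      (cong length (filter-reject covers {xs = []} (∉block ∘ ∈-block⁻ {c = j ∷ js})))
      (cong length (filter-reject starts {x = j ∷ js} {xs = []} j≢i))
      (count-≟-∉ i∉)
      where
      ∉block : i ∉ j ∷ js
      ∉block (here refl) = j≢i refl
      ∉block (there i∈)  = i∉ i∈

labelsFrom-kind : ∀ {n} {cs : List (Cycle n)} → Proper cs → ∀ i κ → HasKind cs i κ →
  labelsFrom i (count (λ c → i ∈ₛ? block c) cs) (filter (λ c → List⁺.head c Fin.≟ i) cs) ≡ kindLabels i κ
labelsFrom-kind {cs = cs} proper i κ (opening , closing) =
  trans (cong (λ m → labelsFrom i m starting) (count-blocks i cyc)) (labels κ opening closing)
  where
  open Proper proper
  starting = filter (λ c → List⁺.head c Fin.≟ i) cs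
  closings = count (Fin._≟ i) (nonMinima cs)
  starting-∈ : ∀ {is} → (i ∷ is) ∈ cs → starting ≡ (i ∷ is) ∷ []
  starting-∈ c∈ = filter-key-unique List⁺.head Fin._≟_ minima! c∈
  starting-∉ : i ∉ minima cs → starting ≡ []
  starting-∉ i∉ = filter-none (λ c → List⁺.head c Fin.≟ i) (All.tabulate λ { c∈ refl → i∉ (∈-map⁺ List⁺.head c∈) })
  labelsWith : ∀ {fs k} → starting ≡ fs → closings ≡ k →
    labelsFrom i (length starting ℕ.+ closings) starting ≡ labelsFrom i (length fs ℕ.+ k) fs
  labelsWith eq eq′ = cong₂ (λ fs k → labelsFrom i (length fs ℕ.+ k) fs) eq eq′
  labels : ∀ κ → Opens cs i (tailLength κ) → Closes cs i (closes κ) →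
    labelsFrom i (length starting ℕ.+ closings) starting ≡ kindLabels i κ
  labels singleton ([] , c∈ , _) i∉ = labelsWith (starting-∈ c∈) (count-≟-∉ i∉)
  labels closer i∉ i∈ = labelsWith (starting-∉ i∉) (count-≟-∈ nonMinima! i∈)
  labels (opener k) (_ ∷ _ , c∈ , refl) i∉ = labelsWith (starting-∈ c∈) (count-≟-∉ i∉)
  labels (transient k) (_ ∷ _ , c∈ , refl) i∈ = labelsWith (starting-∈ c∈) (count-≟-∈ nonMinima! i∈)

HasKinds : ∀ {n} → (Fin n → Kind) → List (Cycle n) → Set
HasKinds κ cs = ∀ i → HasKind cs i (κ i)

properCycles : ∀ {n} (π : LinkedCycle n) → Proper (cycles π)
properCycles π = linked⇒proper (isCycle π) (isLinkedPartition π)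

labeling-kinds : ∀ {n} (π : LinkedCycle n) {κ} → HasKinds κ (cycles π) → labeling π ≡ kindLabeling κ
labeling-kinds {n} π {κ} kinds =
  concatMap-cong (λ i → labelsFrom-kind (properCycles π) i (κ i) (kinds i)) (allFin n)

-- `π` has kinds of its own, and their labeling is also `labeling π`. Injectivity identifies them
-- with `κ`.
kinds-labeling : ∀ {n} (π : LinkedCycle n) {κ} → labeling π ≡ kindLabeling κ → HasKinds κ (cycles π)
kinds-labeling π {κ} eq i = subst (HasKind (cycles π) i)
  (kindLabeling-injective kind κ (trans (sym (labeling-kinds π hasKind)) eq) i)
  (hasKind i)
  where
  kind = λ i → proj₁ (kindOf (properCycles π) i)
  hasKind : HasKinds kind (cycles π)
  hasKind i = proj₂ (kindOf (properCycles π) i)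

-- Linked cycles as matchings

++-injective : (as bs : List A) {cs ds : List A} → length as ≡ length bs →
  as ++ cs ≡ bs ++ ds → as ≡ bs × cs ≡ ds
++-injective []       []       _   eq = refl , eq
++-injective (_ ∷ as) (_ ∷ bs) len eq with ∷-injective eq
... | refl , eq′ with ++-injective as bs (ℕ.suc-injective len) eq′
... | refl , eq″ = refl , eq″

zip-++ : (as : List A) (bs : List B) {cs : List A} {ds : List B} → length as ≡ length bs →
  zip (as ++ cs) (bs ++ ds) ≡ zip as bs ++ zip cs ds
zip-++ []       []       _   = refl
zip-++ (a ∷ as) (b ∷ bs) len = cong ((a , b) ∷_) (zip-++ as bs (ℕ.suc-injective len))

Pointwise-++⁻ : {R : REL A B 0ℓ} (as : List A) {bs : List A} {cs : List B} → Pointwise R (as ++ bs) cs →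
  ∃ λ ds → ∃ λ es → cs ≡ ds ++ es × Pointwise R as ds × Pointwise R bs es
Pointwise-++⁻ []       {cs = cs} rs = [] , cs , refl , [] , rs
Pointwise-++⁻ (a ∷ as) (r ∷ rs) with Pointwise-++⁻ as rs
... | ds , es , refl , rs₁ , rs₂ = _ ∷ ds , es , refl , r ∷ rs₁ , rs₂

AllPairs-reverse⁺ : {R : Rel A 0ℓ} → AllPairs R xs → AllPairs (flip R) (reverse xs)
AllPairs-reverse⁺ [] = []
AllPairs-reverse⁺ {xs = x ∷ xs} {R} (Rx ∷ Rxs) = subst (AllPairs (flip R)) (sym (unfold-reverse x xs))
  (AllPairs.++⁺ (AllPairs-reverse⁺ Rxs) ([] ∷ [])
    (All.map (_∷ []) (All-resp-↭ (↭-sym (↭-reverse xs)) Rx)))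

right : ∀ {n} → Fin n → Vertex n
right i = i , 0

Below : ∀ {n} → Vertex n → Fin n → Set
Below v i = v ≺ right i

-- No superscript is smaller than 0, so the comparison is decided by the elements.
Below⇒< : ∀ {n} {i j : Fin n} {k} → Below (i , k) j → i Fin.< j
Below⇒< (inj₁ i<j) = i<j

leftsAt : ∀ {n} → Fin n → Maybe ℕ → List (Vertex n)
leftsAt i nothing  = []
leftsAt i (just k) = map (λ j → i , suc j) (downFrom k)

length-leftsAt : ∀ {n} (i : Fin n) k → length (leftsAt i (just k)) ≡ k
length-leftsAt i k = trans (length-map _ (downFrom k)) (length-downFrom k)

-- Since i^(j) is joined to iₜ₊₁₋ⱼ, the descending order of the left endpoints at i
-- corresponds to reading the cycle (i i₂ … iₜ) forwards.
cycleArcs-↭ : ∀ {n} (i : Fin n) is →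
  cycleArcs (i ∷ is) ↭ zip (leftsAt i (just (length is))) (map right is)
cycleArcs-↭ i is = begin
  map arc (zip (upFrom1 (length is)) (reverse is))
    ↭⟨ Perm.map⁺ arc (zip-reverse-↭ is) ⟩
  map arc (zip (map suc (downFrom (length is))) is)
    ≡⟨ zip-map (i ,_) right (map suc (downFrom (length is))) is ⟨
  zip (map (i ,_) (map suc (downFrom (length is)))) (map right is)
    ≡⟨ cong (λ vs → zip vs (map right is)) (map-∘ (downFrom (length is))) ⟨
  zip (leftsAt i (just (length is))) (map right is) ∎
  where
  open PermutationReasoning
  arc : ℕ × Fin _ → Arc _
  arc (j , k) = (i , j) , right k
  zip-reverse-↭ : ∀ is → zip (upFrom1 (length is)) (reverse is) ↭ zip (map suc (downFrom (length is))) is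
  zip-reverse-↭ []       = refl
  zip-reverse-↭ (j ∷ js) = begin
    zip (map suc (upTo (suc k))) (reverse (j ∷ js))
      -- The largest superscript belongs to the first entry of the tail. Both lists are split at the
      -- right end, where reversal has put `j`.
      ≡⟨ cong₂ zip (trans (cong (map suc) (sym (upTo-∷ʳ k))) (map-++ suc (upTo k) (k ∷ [])))
                   (unfold-reverse j js) ⟩
    zip (map suc (upTo k) ++ suc k ∷ []) (reverse js ++ j ∷ [])
      ≡⟨ zip-++ (map suc (upTo k)) (reverse js)
           (trans (length-map suc (upTo k)) (trans (length-upTo k) (sym (length-reverse js)))) ⟩
    zip (upFrom1 k) (reverse js) ++ (suc k , j) ∷ []
      ↭⟨ Perm.∷↭∷ʳ (suc k , j) (zip (upFrom1 k) (reverse js)) ⟨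
    (suc k , j) ∷ zip (upFrom1 k) (reverse js)
      ↭⟨ prep _ (zip-reverse-↭ js) ⟩
    zip (map suc (downFrom (suc k))) (j ∷ js) ∎
    where k = length js

descending : ∀ n → List (Fin n)
descending n = reverse (allFin n)

descending> : ∀ {n} → AllPairs Fin._>_ (descending n)
descending> = AllPairs-reverse⁺ (AllPairs.tabulate⁺-< id)

∈-descending : ∀ {n} (i : Fin n) → i ∈ descending n
∈-descending {n} i = ∈-resp-↭ (↭-sym (↭-reverse (allFin n))) (∈-allFin i)

module _ {n : ℕ} (κ : Fin n → Kind) where

  lefts : List (Fin n) → List (Vertex n)
  lefts = concatMap (λ i → leftsAt i (tailLength (κ i)))

  closers : List (Fin n)
  closers = filter (λ i → closes (κ i) Bool.≟ true) (allFin n)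

  -- The shape of a canonical list of cycles: it follows the order of `is`, with one cycle of the
  -- prescribed length for each element that opens one. Which elements fill the tails is governed
  -- separately, by `nonMinima cs ↭ closers`.
  data Fits : List (Fin n) → List (Cycle n) → Set where
    []   : Fits [] []
    skip : ∀ {i is cs} → tailLength (κ i) ≡ nothing → Fits is cs → Fits (i ∷ is) cs
    keep : ∀ {i is js cs} → tailLength (κ i) ≡ just (length js) → All (i Fin.<_) js →
      Fits is cs → Fits (i ∷ is) ((i ∷ js) ∷ cs)

  -- The kinds say where to cut `js` into tails, and `Below` puts every entry of a tail above its
  -- minimum.
  assemble : ∀ is js → Pointwise Below (lefts is) js → ∃ λ cs → Fits is cs × nonMinima cs ≡ js
  assemble []       [] [] = [] , [] , refl
  assemble (i ∷ is) js below with tailLength (κ i) in eq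
  ... | nothing with assemble is js below
  ...   | cs , fits , refl = cs , skip eq fits , refl
  assemble (i ∷ is) js below | just k with Pointwise-++⁻ (leftsAt i (just k)) below
  ... | ks , ls , refl , belowᵢ , below′ with assemble is ls below′
  ... | cs , fits , refl = (i ∷ ks) ∷ cs , keep (trans eq (cong just len)) (above belowᵢ) fits , refl
    where
    len : k ≡ length ks
    len = trans (sym (length-leftsAt i k)) (Pointwise.Pointwise-length belowᵢ)
    above : ∀ {js ks} → Pointwise Below (map (λ j → i , suc j) js) ks → All (i Fin.<_) ks
    above {[]}    []       = []
    above {_ ∷ _} (b ∷ bs) = Below⇒< b ∷ above bs

  lefts-skip : ∀ {i} is → tailLength (κ i) ≡ nothing → lefts (i ∷ is) ≡ lefts is
  lefts-skip {i} is eq = cong (λ m → leftsAt i m ++ lefts is) eq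

  lefts-open : ∀ {i k} is → tailLength (κ i) ≡ just k → lefts (i ∷ is) ≡ leftsAt i (just k) ++ lefts is
  lefts-open {i} is eq = cong (λ m → leftsAt i m ++ lefts is) eq

  fits-below : ∀ {is cs} → Fits is cs → Pointwise Below (lefts is) (nonMinima cs)
  fits-below [] = []
  fits-below {i ∷ is} {cs} (skip eq fits) =
    subst (λ vs → Pointwise Below vs (nonMinima cs)) (sym (lefts-skip is eq)) (fits-below fits)
  fits-below {i ∷ is} {c ∷ cs} (keep eq i< fits) =
    subst (λ vs → Pointwise Below vs (nonMinima (c ∷ cs))) (sym (lefts-open is eq))
          (Pointwise.++⁺ (belowAt i<) (fits-below fits))
    where
    belowAt : ∀ {js} → All (i Fin.<_) js → Pointwise Below (leftsAt i (just (length js))) js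
    belowAt []       = []
    belowAt (p ∷ ps) = inj₁ p ∷ belowAt ps

  fits-arcs : ∀ {is cs} → Fits is cs → concatMap cycleArcs cs ↭ zip (lefts is) (map right (nonMinima cs))
  fits-arcs [] = refl
  fits-arcs {i ∷ is} {cs} (skip eq fits) =
    subst (λ vs → concatMap cycleArcs cs ↭ zip vs (map right (nonMinima cs))) (sym (lefts-skip is eq)) (fits-arcs fits)
  fits-arcs {i ∷ is} {(i ∷ js) ∷ cs} (keep eq i< fits) = begin
    cycleArcs (i ∷ js) ++ concatMap cycleArcs cs
      ↭⟨ Perm.++⁺ (cycleArcs-↭ i js) (fits-arcs fits) ⟩
    zip (leftsAt i (just (length js))) (map right js) ++ zip (lefts is) (map right (nonMinima cs))
      ≡⟨ zip-++ (leftsAt i (just (length js))) (map right js)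
           (trans (length-leftsAt i (length js)) (sym (length-map right js))) ⟨
    zip (leftsAt i (just (length js)) ++ lefts is) (map right js ++ map right (nonMinima cs))
      ≡⟨ cong₂ zip (sym (lefts-open is eq)) (sym (map-++ right js (nonMinima cs))) ⟩
    zip (lefts (i ∷ is)) (map right (nonMinima ((i ∷ js) ∷ cs))) ∎
    where open PermutationReasoning

  -- Corresponding tails have the same prescribed length, so the concatenation determines them one
  -- by one.
  fits-injective : ∀ {is cs ds} → Fits is cs → Fits is ds → nonMinima cs ≡ nonMinima ds → cs ≡ ds
  fits-injective [] [] _ = refl
  fits-injective (skip _ f) (skip _ g) eq = fits-injective f g eq
  fits-injective (skip p _) (keep q _ _) _ = contradiction (trans (sym p) q) λ ()
  fits-injective (keep p _ _) (skip q _) _ = contradiction (trans (sym q) p) λ ()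
  fits-injective (keep {js = js} p _ f) (keep {js = ks} q _ g) eq
    with ++-injective js ks (just-injective (trans (sym p) q)) eq
  ... | refl , eq′ = cong (_ ∷_) (fits-injective f g eq′)

  fits-minima : ∀ {is cs} → Fits is cs → ∀ {i} → i ∈ minima cs → i ∈ is
  fits-minima (skip _ f)    i∈          = there (fits-minima f i∈)
  fits-minima (keep _ _ f) (here refl) = here refl
  fits-minima (keep _ _ f) (there i∈)  = there (fits-minima f i∈)

  fits-descending : ∀ {is cs} → AllPairs Fin._>_ is → Fits is cs →
    AllPairs (λ c d → List⁺.head c Fin.> List⁺.head d) cs
  fits-descending _ [] = []
  fits-descending (_ ∷ >is) (skip _ f) = fits-descending >is f
  fits-descending (i> ∷ >is) (keep _ _ f) =
    All.tabulate (λ d∈ → All.lookup i> (fits-minima f (∈-map⁺ List⁺.head d∈))) ∷ fits-descending >is f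

  -- Both lists are strictly sorted by their minima, which leaves no freedom of order.
  fits-unique : ∀ {is cs ds} → AllPairs Fin._>_ is → Fits is cs → Fits is ds → cs ↭ ds → cs ≡ ds
  fits-unique >is f g p =
    asym-sorted-↭⇒≡ {R = λ c d → List⁺.head c Fin.> List⁺.head d} (λ c>d d>c → Fin.<-asym c>d d>c)
      (fits-descending >is f) (fits-descending >is g) p

  fits-opens : ∀ {is cs i} → AllPairs Fin._>_ is → Fits is cs → i ∈ is → Opens cs i (tailLength (κ i))
  fits-opens (i> ∷ _) (skip eq f) (here refl) = subst (Opens _ _) (sym eq)
    λ i∈ → Fin.<-irrefl refl (All.lookup i> (fits-minima f i∈))
  fits-opens (_ ∷ >is) (skip _ f) (there i∈) = fits-opens >is f i∈
  fits-opens _ (keep {js = js} eq _ _) (here refl) = subst (Opens _ _) (sym eq) (js , here refl , refl)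
  fits-opens {i = i} (i> ∷ >is) (keep {i = j} _ _ f) (there i∈) = later i≢ (tailLength (κ i)) (fits-opens >is f i∈)
    where
    i≢ : i ≢ j
    i≢ refl = Fin.<-irrefl refl (All.lookup i> i∈)
    later : ∀ {c cs} → i ≢ List⁺.head c → ∀ m → Opens cs i m → Opens (c ∷ cs) i m
    later i≢ nothing  i∉ (here i≡) = i≢ i≡
    later i≢ nothing  i∉ (there i∈)  = i∉ i∈
    later i≢ (just k) (js , c∈ , eq) = js , there c∈ , eq

  fits-heads : ∀ {is cs} → Fits is cs → All (λ c → All (List⁺.head c Fin.<_) (List⁺.tail c)) cs
  fits-heads []             = []
  fits-heads (skip _ f)     = fits-heads f
  fits-heads (keep _ i< f) = i< ∷ fits-heads f

  -- The elements of `is` are visited in turn, and `HasKinds` hands over the cycle with the given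
  -- minimum, if any. The two inclusions later give a permutation of `cs`.
  sort : ∀ {cs} → Proper cs → HasKinds κ cs → ∀ is →
    ∃ λ ds → Fits is ds × (∀ {c} → c ∈ ds → c ∈ cs) × (∀ {c} → c ∈ cs → List⁺.head c ∈ is → c ∈ ds)
  sort proper kinds [] = [] , [] , (λ ()) , λ _ ()
  sort {cs} proper kinds (i ∷ is) with sort proper kinds is | tailLength (κ i) in eq | proj₁ (kinds i)
  ... | ds , fits , to , from | nothing | i∉ = ds , skip eq fits , to , λ where
    c∈ (here refl) → contradiction (∈-map⁺ List⁺.head c∈) i∉
    c∈ (there i∈)  → from c∈ i∈
  ... | ds , fits , to , from | just _ | js , c∈ , refl =
    (i ∷ js) ∷ ds , keep eq (proj₁ (All.lookup (Proper.cyc proper) c∈)) fits ,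
    (λ { (here refl) → c∈ ; (there d∈) → to d∈ }) , λ where
      d∈ (here refl) → here (Proper.sameMin proper d∈ c∈ refl)
      d∈ (there i∈)  → there (from d∈ i∈)

  ∈-closers⁺ : ∀ {i} → closes (κ i) ≡ true → i ∈ closers
  ∈-closers⁺ {i} = ∈-filter⁺ (λ i → closes (κ i) Bool.≟ true) (∈-allFin i)

  ∈-closers⁻ : ∀ {i} → i ∈ closers → closes (κ i) ≡ true
  ∈-closers⁻ i∈ = proj₂ (∈-filter⁻ (λ i → closes (κ i) Bool.≟ true) {xs = allFin n} i∈)

  closers! : Unique closers
  closers! = Unique.filter⁺ (λ i → closes (κ i) Bool.≟ true) (Unique.allFin⁺ n)

  nonMinima-closers : ∀ {cs} → Proper cs → HasKinds κ cs → nonMinima cs ↭ closers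
  nonMinima-closers {cs} proper kinds = unique∧set⇒↭ (Proper.nonMinima! proper) closers!
    (λ {i} i∈ → ∈-closers⁺ (closing i i∈)) (λ {i} i∈ → subst (Closes cs i) (∈-closers⁻ i∈) (proj₂ (kinds i)))
    where
    closing : ∀ i → i ∈ nonMinima cs → closes (κ i) ≡ true
    closing i i∈ with closes (κ i) | proj₂ (kinds i)
    ... | true  | _  = refl
    ... | false | i∉ = contradiction i∈ i∉

  sortedCycles : ∀ {cs} → Proper cs → HasKinds κ cs → ∃ λ ds → Fits (descending n) ds × ds ↭ cs
  sortedCycles {cs} proper kinds with sort proper kinds (descending n)
  ... | ds , fits , to , from = ds , fits , unique∧set⇒↭
    (AllPairs.map (λ { c>d refl → Fin.<-irrefl refl c>d }) (fits-descending descending> fits))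
    (Unique.map⁻ (Proper.minima! proper)) to (λ {c} c∈ → from c∈ (∈-descending (List⁺.head c)))

-- Endpoints of a labeling

leftEndpoints-concatMap : ∀ {n} (f : A → List (Label n)) (xs : List A) →
  leftEndpoints (concatMap f xs) ≡ concatMap (leftEndpoints ∘ f) xs
leftEndpoints-concatMap f []       = refl
leftEndpoints-concatMap f (x ∷ xs) = begin
  map vertex (filterᵇ isLeft (f x ++ concatMap f xs))
    ≡⟨ cong (map vertex) (filter-++ _ (f x) (concatMap f xs)) ⟩
  map vertex (filterᵇ isLeft (f x) ++ filterᵇ isLeft (concatMap f xs))
    ≡⟨ map-++ vertex (filterᵇ isLeft (f x)) _ ⟩
  leftEndpoints (f x) ++ leftEndpoints (concatMap f xs)
    ≡⟨ cong (leftEndpoints (f x) ++_) (leftEndpoints-concatMap f xs) ⟩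
  leftEndpoints (f x) ++ concatMap (leftEndpoints ∘ f) xs ∎
  where open ≡-Reasoning

leftEndpoints-lefts : ∀ {n} (i : Fin n) ks →
  leftEndpoints (map (λ j → endpoint (i , j)) (map suc ks)) ≡ map (λ j → i , suc j) ks
leftEndpoints-lefts i []       = refl
leftEndpoints-lefts i (k ∷ ks) = cong ((i , suc k) ∷_) (leftEndpoints-lefts i ks)

leftEndpoints-kindLabels : ∀ {n} (i : Fin n) κ → leftEndpoints (kindLabels i κ) ↭ leftsAt i (tailLength κ)
leftEndpoints-kindLabels i singleton     = refl
leftEndpoints-kindLabels i closer        = refl
leftEndpoints-kindLabels i (opener k)    = begin
  leftEndpoints (kindLabels i (opener k))       ≡⟨ leftEndpoints-lefts i (upTo (suc k)) ⟩
  map (λ j → i , suc j) (upTo (suc k))          ↭⟨ Perm.map⁺ _ (↭-reverse (upTo (suc k))) ⟨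
  map (λ j → i , suc j) (reverse (upTo (suc k))) ≡⟨ cong (map _) (reverse-upTo (suc k)) ⟩
  leftsAt i (just (suc k))                      ∎
  where open PermutationReasoning
leftEndpoints-kindLabels i (transient k) = leftEndpoints-kindLabels i (opener k)

rightEndpoints-lefts : ∀ {n} (i : Fin n) ks → rightEndpoints (map (λ j → endpoint (i , j)) (map suc ks)) ≡ []
rightEndpoints-lefts i []       = refl
rightEndpoints-lefts i (k ∷ ks) = rightEndpoints-lefts i ks

rightEndpoints-kindLabels : ∀ {n} (i : Fin n) κ →
  rightEndpoints (kindLabels i κ) ≡ (if closes κ then right i ∷ [] else [])
rightEndpoints-kindLabels i singleton     = refl
rightEndpoints-kindLabels i closer        = refl
rightEndpoints-kindLabels i (opener k)    = rightEndpoints-lefts i (upTo (suc k))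
rightEndpoints-kindLabels i (transient k) = cong (right i ∷_) (rightEndpoints-lefts i (upTo (suc k)))

right-injective : ∀ {n} {i j : Fin n} → right i ≡ right j → i ≡ j
right-injective refl = refl

Below⁺ : ∀ {n us} {is : List (Fin n)} → Pointwise _≺_ us (map right is) → Pointwise Below us is
Below⁺ {is = []}    []       = []
Below⁺ {is = _ ∷ _} (b ∷ bs) = b ∷ Below⁺ bs

Below⁻ : ∀ {n us} {is : List (Fin n)} → Pointwise Below us is → Pointwise _≺_ us (map right is)
Below⁻ []       = []
Below⁻ (b ∷ bs) = b ∷ Below⁻ bs

map-proj₁-toList : {P : A → Set} (pxs : All P xs) → map proj₁ (All.toList pxs) ≡ xs
map-proj₁-toList []         = refl
map-proj₁-toList (_ ∷ pxs) = cong (_ ∷_) (map-proj₁-toList pxs)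

-- The bijection between linked cycles and matchings

module _ {n : ℕ} (κ : Fin n → Kind) where

  -- The labeling lists left endpoints in ascending order, the matchings in descending order.
  -- Heights and commutative products are insensitive to this.
  leftEndpoints-kindLabeling : leftEndpoints (kindLabeling κ) ↭ lefts κ (descending n)
  leftEndpoints-kindLabeling = begin
    leftEndpoints (kindLabeling κ)
      ≡⟨ leftEndpoints-concatMap (λ i → kindLabels i (κ i)) (allFin n) ⟩
    concatMap (λ i → leftEndpoints (kindLabels i (κ i))) (allFin n)
      ↭⟨ concatMap-cong-↭ (All.universal (λ i → leftEndpoints-kindLabels i (κ i)) (allFin n)) ⟩
    lefts κ (allFin n)
      ↭⟨ concatMap⁺-↭ _ (↭-reverse (allFin n)) ⟨
    lefts κ (descending n) ∎
    where open PermutationReasoning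

  rightEndpoints-kindLabeling : rightEndpoints (kindLabeling κ) ≡ map right (closers κ)
  rightEndpoints-kindLabeling = rights (allFin n)
    where
    open ≡-Reasoning
    P? = λ i → closes (κ i) Bool.≟ true
    rights : ∀ is → rightEndpoints (concatMap (λ i → kindLabels i (κ i)) is) ≡ map right (filter P? is)
    rights []       = refl
    rights (i ∷ is) = begin
      rightEndpoints (kindLabels i (κ i) ++ rest)
        ≡⟨ cong (map vertex) (filter-++ _ (kindLabels i (κ i)) rest) ⟩
      map vertex (filterᵇ isRight (kindLabels i (κ i)) ++ filterᵇ isRight rest)
        ≡⟨ map-++ vertex (filterᵇ isRight (kindLabels i (κ i))) _ ⟩
      rightEndpoints (kindLabels i (κ i)) ++ rightEndpoints rest
        ≡⟨ cong₂ _++_ (rightEndpoints-kindLabels i (κ i)) (rights is) ⟩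
      (if closes (κ i) then right i ∷ [] else []) ++ map right (filter P? is)
        ≡⟨ split (closes (κ i) Bool.≟ true) ⟩
      map right (filter P? (i ∷ is)) ∎
      where
      rest = concatMap (λ i → kindLabels i (κ i)) is
      split : Dec (closes (κ i) ≡ true) →
        (if closes (κ i) then right i ∷ [] else []) ++ map right (filter P? is) ≡ map right (filter P? (i ∷ is))
      split (yes p) = trans (cong (λ b → (if b then right i ∷ [] else []) ++ map right (filter P? is)) p)
                            (sym (cong (map right) (filter-accept P? p)))
      split (no ¬p) = trans (cong (λ b → (if b then right i ∷ [] else []) ++ map right (filter P? is)) (Bool.¬-not ¬p))
                            (sym (cong (map right) (filter-reject P? ¬p)))

  lefts-descending : ∀ {is} → AllPairs Fin._>_ is → AllPairs _≻_ (lefts κ is)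
  lefts-descending {is} >is = AllPairs.concat⁺
    (All.map⁺ (All.universal (λ i → within i (tailLength (κ i))) is))
    (AllPairs.map⁺ (AllPairs.map (λ {i} {j} → between (tailLength (κ i)) (tailLength (κ j))) >is))
    where
    within : ∀ i m → AllPairs _≻_ (leftsAt i m)
    within i nothing  = []
    within i (just k) = AllPairs.map⁺ (AllPairs.applyDownFrom⁺₁ id k λ j<i _ → inj₂ (refl , s≤s j<i))
    at : ∀ (i : Fin n) m → All (λ v → proj₁ v ≡ i) (leftsAt i m)
    at i nothing  = []
    at i (just k) = All.map⁺ (All.universal (λ _ → refl) (downFrom k))
    between : ∀ {i j : Fin n} m m′ → i Fin.> j → All (λ u → All (u ≻_) (leftsAt j m′)) (leftsAt i m)
    between {i} {j} m m′ i>j = All.map (λ { refl → All.map (λ { refl → inj₁ i>j }) (at j m′) }) (at i m)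

  fits⇒kinds : ∀ {cs} → Fits κ (descending n) cs → nonMinima cs ↭ closers κ → HasKinds κ cs
  fits⇒kinds {cs} fits p i =
    fits-opens κ descending> fits (∈-descending i) , closing (closes (κ i)) refl
    where
    closing : ∀ b → closes (κ i) ≡ b → Closes cs i b
    closing true  eq = ∈-resp-↭ (↭-sym p) (∈-closers⁺ κ eq)
    closing false eq i∈ = contradiction (trans (sym eq) (∈-closers⁻ κ (∈-resp-↭ p i∈))) λ ()

  fits⇒proper : ∀ {cs} → Fits κ (descending n) cs → nonMinima cs ↭ closers κ → Proper cs
  fits⇒proper {cs} fits p = record
    { cyc        = All.zip (fits-heads κ fits , Unique-concatMap⁻ List⁺.tail cs nonMinima!)
    ; minima!    = minima!
    ; nonMinima! = nonMinima!
    ; cover      = λ i → cover (κ i) (kinds i)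
    ; bigMins    = λ {i} → big (κ i) (kinds i)
    }
    where
    kinds : HasKinds κ cs
    kinds = fits⇒kinds fits p
    minima! : Unique (minima cs)
    minima! = AllPairs.map⁺
      (AllPairs.map (λ c>d c≡d → Fin.<-irrefl (sym c≡d) c>d) (fits-descending κ descending> fits))
    nonMinima! : Unique (nonMinima cs)
    nonMinima! = Unique-resp-↭ (↭-sym p) (closers! κ)
    cover : ∀ {i} k → HasKind cs i k → i ∈ minima cs ⊎ i ∈ nonMinima cs
    cover singleton     ((_ , c∈ , _) , _) = inj₁ (∈-map⁺ List⁺.head c∈)
    cover closer        (_ , i∈)           = inj₂ i∈
    cover (opener k)    ((_ , c∈ , _) , _) = inj₁ (∈-map⁺ List⁺.head c∈)
    cover (transient k) ((_ , c∈ , _) , _) = inj₁ (∈-map⁺ List⁺.head c∈)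
    big : ∀ {i} k → HasKind cs i k → (i ∷ []) ∈ cs → i ∉ nonMinima cs
    big singleton     (_ , i∉)           _  = i∉
    big closer        (i∉ , _)           c∈ = contradiction (∈-map⁺ List⁺.head c∈) i∉
    big (opener k)    (_ , i∉)           _  = i∉
    -- A transient element opens a cycle with nonempty tail. By uniqueness of minima this would be
    -- the singleton cycle.
    big (transient k) ((_ , d∈ , eq) , _) c∈ with Unique-map-injective List⁺.head minima! c∈ d∈ refl
    ... | refl = contradiction eq λ ()

  us vs : List (Vertex n)
  us = lefts κ (descending n)
  vs = map right (closers κ)

  LC′ : Set
  LC′ = Setoid.Carrier (LC n (kindLabeling κ))

  fromFits : ∀ {cs} → Fits κ (descending n) cs → nonMinima cs ↭ closers κ → ∃ λ (π : LC′) → cycles (proj₁ π) ≡ cs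
  fromFits {cs} fits p = (π , labeling-kinds π (fits⇒kinds fits p)) , refl
    where
    proper : Proper cs
    proper = fits⇒proper fits p
    π : LinkedCycle n
    π = record { cycles = cs ; isCycle = Proper.cyc proper ; isLinkedPartition = proper⇒linked proper }

  abstract
    -- Opaque, since only these properties of the list matter and not how it was found.
    canonical : (π : LC′) → ∃ λ cs → Fits κ (descending n) cs × cs ↭ cycles (proj₁ π)
    canonical (π , eq) = sortedCycles κ (properCycles π) (kinds-labeling π eq)

  -- The right ends of the arcs of π, listed by descending left ends.
  ends : LC′ → List (Vertex n)
  ends π = map right (nonMinima (proj₁ (canonical π)))

  ends-matching : ∀ π → Matching us vs (ends π)
  ends-matching (π , eq) with canonical (π , eq)
  ... | cs , fits , p = Below⁻ (fits-below κ fits) , Perm.map⁺ right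
    (↭trans (concatMap⁺-↭ List⁺.tail p) (nonMinima-closers κ (properCycles π) (kinds-labeling π eq)))

  ends-exponents : ∀ π → exponents (arcs (proj₁ π)) ≡ exponents (zip us (ends π))
  ends-exponents π with canonical π
  ... | cs , fits , p = exponents-↭ (↭trans (concatMap⁺-↭ cycleArcs (↭-sym p)) (fits-arcs κ fits))

  -- This makes `ends` well defined on linked cycles, where the order of the cycles is irrelevant.
  ends-cong : ∀ π ρ → cycles (proj₁ π) ↭ cycles (proj₁ ρ) → ends π ≡ ends ρ
  ends-cong π ρ π≈ρ with canonical π | canonical ρ
  ... | cs , fits , p | ds , fits′ , q = cong (map right ∘ nonMinima)
    (fits-unique κ descending> fits fits′ (↭trans p (↭trans π≈ρ (↭-sym q))))

  ends-injective : ∀ π ρ → ends π ≡ ends ρ → cycles (proj₁ π) ↭ cycles (proj₁ ρ)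
  ends-injective π ρ eq with canonical π | canonical ρ
  ... | cs , fits , p | ds , fits′ , q with fits-injective κ fits fits′ (map-injective right-injective eq)
  ... | refl = ↭trans (↭-sym p) q

  fromEnds : ∀ {ys} → Matching us vs ys → ∃ λ π → ends π ≡ ys
  fromEnds (us≺ys , ys↭vs) with Perm.↭-map-inv right (↭-sym ys↭vs)
  ... | is , refl , p with assemble κ (descending n) is (Below⁺ us≺ys)
  ... | cs , fits , refl with fromFits fits (↭-sym p)
  -- `canonical` need not return the assembled list by computation, but both lists are canonical and
  -- permutations of each other.
  ... | π , refl = π , cong (map right ∘ nonMinima)
    (fits-unique κ descending> (proj₁ (proj₂ (canonical π))) fits (proj₂ (proj₂ (canonical π))))

  vs-ascending : AllPairs _≺_ vs
  vs-ascending = AllPairs.map⁺ (AllPairs.map inj₁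
    (AllPairs.filter⁺ (λ i → closes (κ i) Bool.≟ true) (AllPairs.tabulate⁺-< id)))

  vs! : Unique vs
  vs! = AllPairs.map (λ { u≺u refl → ≺-irrefl u≺u }) vs-ascending

  -- `ends` maps the constructed list exactly onto `matchings us vs`. Completeness then rests on the
  -- injectivity of `ends`, and absence of duplicates on its invariance.
  enumeration : ∃ (Enumerates (LC n (kindLabeling κ)))
  enumeration = πs , record { complete = complete ; noDuplicates = noDuplicates }
    where
    sound : All (Matching us vs) (matchings us vs)
    sound = All.tabulate (matchings-sound us)
    πs : List LC′
    πs = map (λ (_ , m) → proj₁ (fromEnds m)) (All.toList sound)
    ends-πs : map ends πs ≡ matchings us vs
    ends-πs = begin
      map ends πs                                                     ≡⟨ map-∘ (All.toList sound) ⟨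
      map (λ (_ , m) → ends (proj₁ (fromEnds m))) (All.toList sound)
        ≡⟨ map-cong (λ (_ , m) → proj₂ (fromEnds m)) (All.toList sound) ⟩
      map proj₁ (All.toList sound)                                    ≡⟨ map-proj₁-toList sound ⟩
      matchings us vs                                                 ∎
      where open ≡-Reasoning
    complete : ∀ π → Any (λ ρ → cycles (proj₁ π) ↭ cycles (proj₁ ρ)) πs
    complete π with ∈-map⁻ ends (subst (ends π ∈_) (sym ends-πs) (matchings-complete (ends-matching π)))
    ... | ρ , ρ∈ , eq = Any.map (λ { refl → ends-injective π ρ eq }) ρ∈
    noDuplicates : AllPairs (λ π ρ → ¬ (cycles (proj₁ π) ↭ cycles (proj₁ ρ))) πs
    noDuplicates = AllPairs.map (λ {π} {ρ} ends≢ π≈ρ → ends≢ (ends-cong π ρ π≈ρ))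
      (AllPairs.map⁻ (subst Unique (sym ends-πs) (matchings-unique us vs!)))

  ends-enumeration : ∀ {πs} → Enumerates (LC n (kindLabeling κ)) πs → map ends πs ↭ matchings us vs
  ends-enumeration {πs} enum = unique∧set⇒↭
    (AllPairs.map⁺ (AllPairs.map (λ {π} {ρ} π≉ρ eq → π≉ρ (ends-injective π ρ eq)) noDuplicates))
    (matchings-unique us vs!) to from
    where
    open Enumerates enum
    to : ∀ {ys} → ys ∈ map ends πs → ys ∈ matchings us vs
    to ys∈ with ∈-map⁻ ends ys∈
    ... | π , _ , refl = matchings-complete (ends-matching π)
    from : ∀ {ys} → ys ∈ matchings us vs → ys ∈ map ends πs
    from ys∈ with fromEnds (matchings-sound us ys∈)
    ... | π , refl = ∈-map⁺′ (complete π)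
      where
      ∈-map⁺′ : ∀ {ρs} → Any (λ ρ → cycles (proj₁ π) ↭ cycles (proj₁ ρ)) ρs → ends π ∈ map ends ρs
      ∈-map⁺′ (here {x = ρ} π≈ρ) = here (ends-cong π ρ π≈ρ)
      ∈-map⁺′ (there π∈)         = there (∈-map⁺′ π∈)

  enumeration-exponents : LC′ → ∀ {πs} → Enumerates (LC n (kindLabeling κ)) πs →
    map (λ π → exponents (arcs (proj₁ π))) πs ↭ productTerms (map (height us vs) us)
  enumeration-exponents π₀ {πs} enum = begin
    map (λ π → exponents (arcs (proj₁ π))) πs     ≡⟨ map-cong ends-exponents πs ⟩
    map (exponents ∘ zip us ∘ ends) πs            ≡⟨ map-∘ πs ⟩
    map (exponents ∘ zip us) (map ends πs)        ↭⟨ Perm.map⁺ _ (ends-enumeration enum) ⟩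
    map (exponents ∘ zip us) (matchings us vs)
      ↭⟨ matchings-exponents (lefts-descending descending>) vs-ascending
           -- The given linked cycle provides one matching, so there are as many left as right
           -- endpoints.
           (trans (Pointwise.Pointwise-length (proj₁ m₀)) (↭-length (proj₂ m₀))) ⟩
    productTerms (map (height us vs) us)          ∎
    where
    open PermutationReasoning
    m₀ = ends-matching π₀

-- Generating functions

module _ {c ℓ} (R : CommutativeSemiring c ℓ) where
  open GeneratingFunctions R
  private
    module R = CommutativeSemiring R
    module ≈-Reasoning = SetoidReasoning R.setoid

  ∑-↭ : {as bs : List A} (f : A → Carrier) → as ↭ bs → ∑ as f ≈ ∑ bs f
  ∑-↭ f p = PermS.foldr-commMonoid R.setoid R.+-isCommutativeMonoid (↭⇒↭ₛ′ R.isEquivalence (Perm.map⁺ f p))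

  ∏-↭ : {as bs : List A} (f : A → Carrier) → as ↭ bs → ∏ as f ≈ ∏ bs f
  ∏-↭ f p = PermS.foldr-commMonoid R.setoid R.*-isCommutativeMonoid (↭⇒↭ₛ′ R.isEquivalence (Perm.map⁺ f p))

  ∑-++ : (as bs : List A) (f : A → Carrier) → ∑ (as ++ bs) f ≈ ∑ as f + ∑ bs f
  ∑-++ []       bs f = R.sym (R.+-identityˡ _)
  ∑-++ (a ∷ as) bs f = R.trans (R.+-congˡ (∑-++ as bs f)) (R.sym (R.+-assoc _ _ _))

  ∑-map : (g : A → B) (as : List A) (f : B → Carrier) → ∑ (map g as) f ≡ ∑ as (f ∘ g)
  ∑-map g as f = cong (foldr _+_ 0#) (sym (map-∘ as))

  module _ (x y : Carrier) where

    monomial : ℕ × ℕ → Carrier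
    monomial (a , b) = x ^ a * y ^ b

    monomial-⊕ : ∀ s t → monomial (s ⊕ t) ≈ monomial s * monomial t
    monomial-⊕ (a , b) (c , d) = R.trans
      (R.*-cong (^-homo-* R.semiring x a c) (^-homo-* R.semiring y b d))
      (interchange R.*-commutativeSemigroup (x ^ a) (x ^ c) (y ^ b) (y ^ d))

    ∑-shift : ∀ t ts → ∑ (map (t ⊕_) ts) monomial ≈ monomial t * ∑ ts monomial
    ∑-shift t []       = R.sym (R.zeroʳ _)
    ∑-shift t (s ∷ ss) = R.trans (R.+-cong (monomial-⊕ t s) (∑-shift t ss)) (R.sym (R.distribˡ _ _ _))

    ∑-product : ∀ ss ts →
      ∑ (concatMap (λ s → map (s ⊕_) ts) ss) monomial ≈ ∑ ss monomial * ∑ ts monomial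
    ∑-product []       ts = R.sym (R.zeroˡ _)
    ∑-product (s ∷ ss) ts = begin
      ∑ (map (s ⊕_) ts ++ concatMap (λ s → map (s ⊕_) ts) ss) monomial
        ≈⟨ ∑-++ (map (s ⊕_) ts) _ monomial ⟩
      ∑ (map (s ⊕_) ts) monomial + ∑ (concatMap (λ s → map (s ⊕_) ts) ss) monomial
        ≈⟨ R.+-cong (∑-shift s ts) (∑-product ss ts) ⟩
      monomial s * ∑ ts monomial + ∑ ss monomial * ∑ ts monomial
        ≈⟨ R.distribʳ _ _ _ ⟨
      ∑ (s ∷ ss) monomial * ∑ ts monomial ∎
      where open ≈-Reasoning

    ∑-productTerms : ∀ ms → ∑ (productTerms ms) monomial ≈ ∏ ms (λ m → [ m ]⟨ x , y ⟩)
    ∑-productTerms []       = R.trans (R.+-identityʳ _) (R.*-identityˡ _)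
    ∑-productTerms (m ∷ ms) = R.trans (∑-product (terms m) (productTerms ms))
      (R.*-cong (R.reflexive (∑-map _ (upTo m) monomial)) (∑-productTerms ms))

-- Symmetry and product formula for a labeling given by kinds

module _ {n : ℕ} (κ : Fin n → Kind) (π₀ : LC′ κ) {πs : List (LC′ κ)}
  (enum : Enumerates (LC n (kindLabeling κ)) πs) where

  private
    L = kindLabeling κ
    ms = map (height (us κ) (vs κ)) (us κ)

  exponentsOf : LC′ κ → ℕ × ℕ
  exponentsOf (π , _) = ne₂ π , cr₂ π

  exponentsOf-↭ : map exponentsOf πs ↭ productTerms ms
  exponentsOf-↭ = enumeration-exponents κ π₀ enum

  -- The symmetry is inherited from the product; no involution on linked cycles is constructed.
  exponentsOf-swap : map exponentsOf πs ↭ map (swap ∘ exponentsOf) πs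
  exponentsOf-swap = begin
    map exponentsOf πs              ↭⟨ exponentsOf-↭ ⟩
    productTerms ms                 ↭⟨ productTerms-swap ms ⟨
    map swap (productTerms ms)      ↭⟨ Perm.map⁺ swap exponentsOf-↭ ⟨
    map swap (map exponentsOf πs)   ≡⟨ map-∘ πs ⟨
    map (swap ∘ exponentsOf) πs     ∎
    where open PermutationReasoning

  height-h : ∀ v → height (us κ) (vs κ) v ≡ h L v
  height-h v = cong₂ _∸_ (cong (count (v ≺?_)) (sym (rightEndpoints-kindLabeling κ)))
                         (count-↭ (v ≺?_) (↭-sym (leftEndpoints-kindLabeling κ)))

  jointCount-symmetric : ∀ a b →
    jointCount (cr₂ ∘ proj₁) (ne₂ ∘ proj₁) a b πs ≡ jointCount (ne₂ ∘ proj₁) (cr₂ ∘ proj₁) a b πs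
  jointCount-symmetric a b = begin
    count (λ π → (cr₂ (proj₁ π) ℕ.≟ a) ×-dec (ne₂ (proj₁ π) ℕ.≟ b)) πs
      ≡⟨ count-map is? (swap ∘ exponentsOf) πs ⟨
    count is? (map (swap ∘ exponentsOf) πs)
      ≡⟨ count-↭ is? exponentsOf-swap ⟨
    count is? (map exponentsOf πs)
      ≡⟨ count-map is? exponentsOf πs ⟩
    count (λ π → (ne₂ (proj₁ π) ℕ.≟ a) ×-dec (cr₂ (proj₁ π) ℕ.≟ b)) πs ∎
    where
    open ≡-Reasoning
    is? : Decidable (λ t → proj₁ t ≡ a × proj₂ t ≡ b)
    is? (c , d) = (c ℕ.≟ a) ×-dec (d ℕ.≟ b)

  module _ {c ℓ} (R : CommutativeSemiring c ℓ) where
    open GeneratingFunctions R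
    private
      module R = CommutativeSemiring R
      module ≈-Reasoning = SetoidReasoning R.setoid

    ∑-symmetric : ∀ x y → ∑ πs (λ (π , _) → x ^ cr₂ π * y ^ ne₂ π) ≈ ∑ πs (λ (π , _) → x ^ ne₂ π * y ^ cr₂ π)
    ∑-symmetric x y = begin
      ∑ πs (monomial R x y ∘ swap ∘ exponentsOf)     ≡⟨ ∑-map R (swap ∘ exponentsOf) πs _ ⟨
      ∑ (map (swap ∘ exponentsOf) πs) (monomial R x y) ≈⟨ ∑-↭ R _ exponentsOf-swap ⟨
      ∑ (map exponentsOf πs) (monomial R x y)        ≡⟨ ∑-map R exponentsOf πs _ ⟩
      ∑ πs (monomial R x y ∘ exponentsOf)            ∎
      where open ≈-Reasoning

    ∑-product-formula : ∀ x y →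
      ∑ πs (λ (π , _) → x ^ ne₂ π * y ^ cr₂ π) ≈ ∏ (leftEndpoints L) (λ v → [ h L v ]⟨ x , y ⟩)
    ∑-product-formula x y = begin
      ∑ πs (monomial R x y ∘ exponentsOf)              ≡⟨ ∑-map R exponentsOf πs _ ⟨
      ∑ (map exponentsOf πs) (monomial R x y)          ≈⟨ ∑-↭ R _ exponentsOf-↭ ⟩
      ∑ (productTerms ms) (monomial R x y)             ≈⟨ ∑-productTerms R x y ms ⟩
      ∏ ms (λ m → [ m ]⟨ x , y ⟩)                      ≡⟨ cong (foldr _*_ 1#) (map-∘ (us κ)) ⟨
      ∏ (us κ) (λ v → [ height (us κ) (vs κ) v ]⟨ x , y ⟩)
        ≡⟨ cong (foldr _*_ 1#) (map-cong (λ v → cong [_]⟨ x , y ⟩ (height-h v)) (us κ)) ⟩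
      ∏ (us κ) (λ v → [ h L v ]⟨ x , y ⟩)              ≈⟨ ∏-↭ R _ (leftEndpoints-kindLabeling κ) ⟨
      ∏ (leftEndpoints L) (λ v → [ h L v ]⟨ x , y ⟩)   ∎
      where open ≈-Reasoning

labeling-kindLabeling : ∀ {n} {L : List (Label n)} → ∃ (λ (π₀ : LinkedCycle n) → labeling π₀ ≡ L) →
  ∃ λ κ → L ≡ kindLabeling κ
labeling-kindLabeling (π₀ , refl) =
  (λ i → proj₁ (kindOf (properCycles π₀) i)) , labeling-kinds π₀ (λ i → proj₂ (kindOf (properCycles π₀) i))

theorem4p9 : ∀ {c ℓ} (n : ℕ) → n ≥ 1 →
    (L : List (Label n)) → ∃ (λ (π₀ : LinkedCycle n) → labeling π₀ ≡ L) →
    ∃ (λ πs → Enumerates (LC n L) πs)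
    × (∀ πs → Enumerates (LC n L) πs →
    (∀ (R : CommutativeSemiring c ℓ) → let open GeneratingFunctions R in
    ∀ (x y : Carrier) →
    (∑ πs (λ (π , _) → x ^ cr₂ π * y ^ ne₂ π)
    ≈ ∑ πs (λ (π , _) → x ^ ne₂ π * y ^ cr₂ π))
    × (∑ πs (λ (π , _) → x ^ ne₂ π * y ^ cr₂ π)
    ≈ ∏ (leftEndpoints L) (λ v → [ h L v ]⟨ x , y ⟩)))
    × (∀ a b → jointCount (cr₂ ∘ proj₁) (ne₂ ∘ proj₁) a b πs
    ≡ jointCount (ne₂ ∘ proj₁) (cr₂ ∘ proj₁) a b πs))
theorem4p9 n _ L π₀ with labeling-kindLabeling π₀
... | κ , refl = enumeration κ , λ πs enum →
    (λ R x y → ∑-symmetric κ π₀ enum R x y , ∑-product-formula κ π₀ enum R x y)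
  , jointCount-symmetric κ π₀ enum
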